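{- Let $p$ be a prime with $p \equiv 2$ or $p \equiv 5 \pmod 9$. Then there exists a nontrivial infinite $F$-set in $\mathbb{F}_p[x]$; that is, there is an infinite set $\mathcal{S}$ of monic irreducible polynomials in $\mathbb{F}_p[x]$ which does not contain every monic irreducible polynomial of $\mathbb{F}_p[x]$, and which has the property that whenever $P \in \mathcal{S}$ and $Q$ is a monic irreducible polynomial in $\mathbb{F}_p[x]$ dividing $P - \alpha_P$ (where $\alpha_P$ is the constant term of $P$), then $Q \in \mathcal{S}$.
   Context: For a prime power $q$, $\mathbb{F}_q$ denotes the finite field with $q$ elements. An $F$-set in $\mathbb{F}_q[x]$ is a set $\mathcal{S}$ of monic irreducible polynomials in $\mathbb{F}_q[x]$ such that if $P \in \mathcal{S}$, $\alpha_P$ denotes the constant term of $P$, and $Q$ is a monic irreducible polynomial with $Q \mid (P - \alpha_P)$, then $Q \in \mathcal{S}$. An $F$-set is nontrivial if it is not the set of all monic irreducible polynomials of $\mathbb{F}_q[x]$. -}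

module Defs where

open import Data.Nat using (ℕ; zero; suc; _+_; _*_; _∸_; _%_)
open import Data.Nat.Primality using (Prime; prime⇒nonZero)
open import Data.Fin using (Fin; toℕ)
open import Data.Vec using (Vec; []; _∷_)
open import Data.List using (List; []; _∷_; [_])
open import Data.List.Membership.Propositional using (_∈_)
open import Data.Product using (Σ; ∃; _×_; _,_)
open import Data.Sum using (_⊎_)
open import Relation.Nullary using (¬_)
open import Relation.Binary.PropositionalEquality using (_≡_)

-- Raw polynomials: little-endian coefficient lists of natural numbers,
-- read modulo p (so they represent elements of F_p[x]).
RawPoly : Set
RawPoly = List ℕ

coeff : RawPoly → ℕ → ℕ
coeff []       _       = 0
coeff (a ∷ f)  zero    = a
coeff (a ∷ f)  (suc i) = coeff f i

_⊕_ : RawPoly → RawPoly → RawPoly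
[]      ⊕ g       = g
(a ∷ f) ⊕ []      = a ∷ f
(a ∷ f) ⊕ (b ∷ g) = (a + b) ∷ (f ⊕ g)

scale : ℕ → RawPoly → RawPoly
scale a []      = []
scale a (b ∷ g) = (a * b) ∷ scale a g

_⊗_ : RawPoly → RawPoly → RawPoly
[]      ⊗ g = []
(a ∷ f) ⊗ g = scale a g ⊕ (0 ∷ (f ⊗ g))

module Poly (p : ℕ) (pp : Prime p) where

  private instance
    p≢0 = prime⇒nonZero pp

  _≈_ : RawPoly → RawPoly → Set
  f ≈ g = ∀ i → coeff f i % p ≡ coeff g i % p

  IsUnit : RawPoly → Set
  IsUnit u = ∃ λ v → (u ⊗ v) ≈ [ 1 ]

  Irreducible : RawPoly → Set
  Irreducible f = ¬ (f ≈ []) × ¬ IsUnit f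
                × (∀ a b → f ≈ (a ⊗ b) → IsUnit a ⊎ IsUnit b)

  _∣ₚ_ : RawPoly → RawPoly → Set
  g ∣ₚ f = ∃ λ h → f ≈ (g ⊗ h)

  constTerm : RawPoly → ℕ
  constTerm f = coeff f 0 % p

  minusConst : RawPoly → RawPoly
  minusConst f = f ⊕ [ p ∸ constTerm f ]

  -- Monic polynomials, canonically: degree d and the d lower coefficients
  -- c_0, …, c_{d-1} in F_p (= Fin p); the leading coefficient is 1.
  Monic : Set
  Monic = Σ ℕ (λ d → Vec (Fin p) d)

  vecToRaw : ∀ {d} → Vec (Fin p) d → RawPoly
  vecToRaw []       = [ 1 ]
  vecToRaw (c ∷ cs) = toℕ c ∷ vecToRaw cs

  toRaw : Monic → RawPoly
  toRaw (d , cs) = vecToRaw cs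

  MonicIrreducible : Monic → Set
  MonicIrreducible P = Irreducible (toRaw P)

  IsFSet : (Monic → Set) → Set
  IsFSet S = (∀ P → S P → MonicIrreducible P)
           × (∀ P Q → S P → MonicIrreducible Q
                    → toRaw Q ∣ₚ minusConst (toRaw P) → S Q)

  Nontrivial : (Monic → Set) → Set
  Nontrivial S = ¬ (∀ Q → MonicIrreducible Q → S Q)

  Infinite : (Monic → Set) → Set
  Infinite S = ¬ (∃ λ (xs : List Monic) → ∀ P → S P → P ∈ xs)

{-# OPTIONS --safe #-}

-- For e = ±1 and m = 3^k put F e m = x^{2m} + e x^m + 1; up to sign changes of x this is the cyclotomic
-- polynomial of order 3^{k+1}. The F-set consists of x, x ± 1 and all the F e 3^k. It is closed because
-- F e m - 1 = x^m (x^m + e), and x^{3m} + e = (x^m + e) · F (-e) m.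
-- The condition on p says that p is a primitive root modulo every power of 3. Irreducibility of F 1 m then
-- follows from a trace argument: let a be a proper factor and ζ the class of x modulo a. By Frobenius
-- a(ζ^{p^i}) = 0, hence a(ζ^j) = 0 for all j prime to 3; averaging ζ^{sj} a(ζ^j) over these j modulo 3m
-- isolates 3m times each coefficient of a, so a = 0. F (-1) m is F 1 m with x replaced by -x.
-- Polynomials are handled as a commutative semiring, with p - 1 playing the role of -1.
module Submission where

open import Defs
open import Level using (_⊔_)
open import Algebra.Bundles using (CommutativeSemiring; CommutativeMonoid)
import Algebra.Properties.Semiring.Mult as SemiringMult
import Algebra.Solver.Ring.NaturalCoefficients.Default as NatSolver
open import Data.Nat as ℕ using (ℕ; zero; suc; _!; _∸_; _%_; s≤s; z≤n; z<s; s<s)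
open import Data.Nat.Combinatorics using (_C_; nCn≡1; k![n∸k]!∣n!; nCk≡n!/k![n-k]!)
open import Data.Nat.Coprimality using (coprime-Bézout; prime⇒coprime)
import Data.Nat.Divisibility as ∣
open import Data.Nat.Divisibility using (_∣_; divides; m%n≡0⇒n∣m; n∣m⇒m%n≡0; _∣?_)
open import Data.Nat.DivMod using (_/_; m/n*n≡m; m≡m%n+[m/n]*n; m%n<n; m%n%n≡m%n; %-distribˡ-+; %-distribˡ-*)
open import Data.Nat.GCD using (module Bézout)
open import Data.Nat.Primality using (Prime; prime⇒nonZero; prime⇒nonTrivial; euclidsLemma)
import Data.Nat.Properties as ℕₚ
open import Data.Nat.Solver using (module +-*-Solver)
open import Data.Fin using (Fin; toℕ; fromℕ<)
open import Data.Fin.Properties using (toℕ<n; toℕ-fromℕ<)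
open import Data.List using (List; []; _∷_; [_]; length)
open import Data.List.Membership.Propositional using (_∈_)
open import Data.List.Relation.Unary.Any using (here; there)
open import Data.Product using (∃; _×_; _,_; proj₁; proj₂; ∃₂)
open import Data.Sum using (_⊎_; inj₁; inj₂; [_,_]′)
open import Data.Vec using (Vec; []; _∷_)
open import Function using (_∘_)
open import Relation.Binary.Definitions using (tri<; tri≈; tri>)
open import Relation.Binary.PropositionalEquality as ≡ using (_≡_; _≢_)
import Relation.Binary.Reasoning.Setoid as SetoidReasoning
open import Relation.Binary.Structures using (IsEquivalence)
open import Relation.Nullary using (¬_; Dec; yes; no; contradiction)
open import Relation.Nullary.Decidable using (from-no)

-- The trace argument uses only identities valid in every commutative ring of characteristic p.
-- Facts about fields are needed only for constants: a nonconstant `a` divides no nonzero constant,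
-- and 3 is invertible modulo p. Averaging with a fixed shift leaves two coefficients of `a`
-- together, those at r and m + r, with weights among 2m and -m. Two shifts give a linear system
-- which, after removing m, has determinant -3; this is the origin of the factor 3m. The residue
-- modulo 9 matters through p^2 being 1 modulo 3 but not modulo 9, which lets generation of the
-- units lift from 3 to all powers of 3. The set is proper for two different reasons. For odd p it
-- misses x + 2, since 4 = 1 would force p = 3. For p = 2 it contains every irreducible of degree at
-- most 2, but all its degrees are 1 or even, so it misses the cubic x^3 + x + 1.

residue3 : ∀ m → (∃ λ q → m ≡ 3 ℕ.* q) ⊎ (∃ λ q → m ≡ 1 ℕ.+ 3 ℕ.* q) ⊎ (∃ λ q → m ≡ 2 ℕ.+ 3 ℕ.* q)
residue3 m with m % 3 | m%n<n m 3 | m≡m%n+[m/n]*n m 3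
... | 0 | _ | eq = inj₁ (m / 3 , ≡.trans eq (ℕₚ.*-comm (m / 3) 3))
... | 1 | _ | eq = inj₂ (inj₁ (m / 3 , ≡.trans eq (≡.cong (1 ℕ.+_) (ℕₚ.*-comm (m / 3) 3))))
... | 2 | _ | eq = inj₂ (inj₂ (m / 3 , ≡.trans eq (≡.cong (2 ℕ.+_) (ℕₚ.*-comm (m / 3) 3))))
... | suc (suc (suc _)) | s≤s (s≤s (s≤s ())) | _

-- Divisibility of binomial coefficients by a prime.

prime∤! : ∀ {p} → Prime p → ∀ k → k ℕ.< p → ¬ p ∣ k !
prime∤! {p} pp zero    k<p p∣ = ℕₚ.<-irrefl (≡.sym (∣.∣1⇒≡1 p∣)) (ℕ.nonTrivial⇒n>1 p {{prime⇒nonTrivial pp}})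
prime∤! pp (suc k) k<p p∣ with euclidsLemma (suc k) (k !) pp p∣
... | inj₁ p∣k  = ∣.>⇒∤ k<p p∣k
... | inj₂ p∣k! = prime∤! pp k (ℕₚ.<-trans (ℕₚ.n<1+n k) k<p) p∣k!

prime∣C : ∀ {p} → Prime p → ∀ {k} → 0 ℕ.< k → k ℕ.< p → p ∣ p C k
prime∣C {p@(suc p-1)} pp {k} 0<k k<p
  with euclidsLemma (p C k) (k ! ℕ.* (p ∸ k) !) pp (≡.subst (p ∣_) (≡.sym C*k!*[p-k]!) (∣.m∣m*n (p-1 !)))
  where
  instance _ = k ℕₚ.!* (p ∸ k) !≢0
  C*k!*[p-k]! : (p C k) ℕ.* (k ! ℕ.* (p ∸ k) !) ≡ p !
  C*k!*[p-k]! = ≡.trans (≡.cong (ℕ._* (k ! ℕ.* (p ∸ k) !)) (nCk≡n!/k![n-k]! (ℕₚ.<⇒≤ k<p)))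
                        (m/n*n≡m (k![n∸k]!∣n! (ℕₚ.<⇒≤ k<p)))
... | inj₁ p∣C = p∣C
... | inj₂ p∣k!*[p-k]! with euclidsLemma (k !) ((p ∸ k) !) pp p∣k!*[p-k]!
...   | inj₁ p∣k!     = contradiction p∣k! (prime∤! pp k k<p)
...   | inj₂ p∣[p-k]! = contradiction p∣[p-k]! (prime∤! pp (p ∸ k) (ℕₚ.∸-monoʳ-< 0<k (ℕₚ.<⇒≤ k<p)))

-- Finite sums in a commutative semiring.

module Sums {c ℓ} (R : CommutativeSemiring c ℓ) where
  open CommutativeSemiring R hiding (zero)
  open import Algebra.Properties.Semiring.Sum semiring as Sum using (sum; sum-cong-≋; *-distribˡ-sum)
  open import Algebra.Properties.CommutativeMonoid.Sum +-commutativeMonoid using (∑-distrib-+; ∑-comm)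
  open SemiringMult semiring renaming (_×_ to _×ᵣ_)
  open import Relation.Binary.Reasoning.Setoid setoid

  -- The summand is a function on all naturals, so that indices can be shifted and used as exponents
  -- without coercions from `Fin`.
  Σ< : ℕ → (ℕ → Carrier) → Carrier
  Σ< n f = sum {n} (f ∘ toℕ)

  Σ<-cong : ∀ n {f g} → (∀ i → i ℕ.< n → f i ≈ g i) → Σ< n f ≈ Σ< n g
  Σ<-cong n eq = sum-cong-≋ {n} (λ i → eq (toℕ i) (toℕ<n i))

  Σ<-zero : ∀ n {f} → (∀ i → i ℕ.< n → f i ≈ 0#) → Σ< n f ≈ 0#
  Σ<-zero zero    eq = refl
  Σ<-zero (suc n) eq = trans (+-cong (eq 0 z<s) (Σ<-zero n (λ i i<n → eq (suc i) (s<s i<n)))) (+-identityˡ 0#)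

  Σ<-single : ∀ n {f} r → r ℕ.< n → (∀ i → i ℕ.< n → i ≢ r → f i ≈ 0#) → Σ< n f ≈ f r
  Σ<-single (suc n) zero    r<n eq =
    trans (+-congˡ (Σ<-zero n (λ i i<n → eq (suc i) (s<s i<n) (λ ())))) (+-identityʳ _)
  Σ<-single (suc n) (suc r) (s<s r<n) eq =
    trans (+-cong (eq 0 z<s (λ ())) (Σ<-single n r r<n (λ i i<n i≢r → eq (suc i) (s<s i<n) (i≢r ∘ ℕₚ.suc-injective))))
          (+-identityˡ _)

  Σ<-split : ∀ m n f → Σ< (m ℕ.+ n) f ≈ Σ< m f + Σ< n (λ i → f (m ℕ.+ i))
  Σ<-split zero    n f = sym (+-identityˡ _)
  Σ<-split (suc m) n f = trans (+-congˡ (Σ<-split m n (f ∘ suc))) (sym (+-assoc _ _ _))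

  Σ<-swap : ∀ m n (f : ℕ → ℕ → Carrier) → Σ< m (λ i → Σ< n (f i)) ≈ Σ< n (λ j → Σ< m (λ i → f i j))
  Σ<-swap m n f = ∑-comm {m} {n} (λ i j → f (toℕ i) (toℕ j))

  Σ<-distrib-+ : ∀ n f g → Σ< n (λ i → f i + g i) ≈ Σ< n f + Σ< n g
  Σ<-distrib-+ n f g = ∑-distrib-+ {n} (f ∘ toℕ) (g ∘ toℕ)

  *-distribˡ-Σ< : ∀ n x f → x * Σ< n f ≈ Σ< n (λ i → x * f i)
  *-distribˡ-Σ< n x f = *-distribˡ-sum {n} x (f ∘ toℕ)

  Σ<-const : ∀ n x → Σ< n (λ _ → x) ≈ n ×ᵣ x
  Σ<-const n x = Sum.sum-replicate n

-- The Frobenius map in characteristic p.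

VanishesIn : ∀ {c ℓ} → CommutativeSemiring c ℓ → ℕ → Set ℓ
VanishesIn R n = n ×ᵣ 1# ≈ 0#
  where
  open CommutativeSemiring R
  open SemiringMult semiring renaming (_×_ to _×ᵣ_)

module Frobenius {c ℓ} (R : CommutativeSemiring c ℓ) (p : ℕ) (pp : Prime p)
  (p×1≈0 : VanishesIn R p) where

  open CommutativeSemiring R hiding (zero)
  open SemiringMult semiring renaming (_×_ to _×ᵣ_)
  open Sums R
  open import Algebra.Properties.CommutativeSemiring.Exp R
  open import Algebra.Properties.CommutativeSemiring.Binomial R using (theorem)
  open import Relation.Binary.Reasoning.Setoid setoid

  p∣⇒×≈0 : ∀ {n} → p ∣ n → ∀ x → n ×ᵣ x ≈ 0#
  p∣⇒×≈0 {n} (divides q ≡.refl) x = begin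
    (q ℕ.* p) ×ᵣ x                    ≈⟨ ×-congʳ (q ℕ.* p) (*-identityˡ x) ⟨
    (q ℕ.* p) ×ᵣ (1# * x)             ≈⟨ ×-assoc-* (q ℕ.* p) 1# x ⟨
    ((q ℕ.* p) ×ᵣ 1#) * x             ≈⟨ *-congʳ (×1-homo-* q p) ⟩
    ((q ×ᵣ 1#) * (p ×ᵣ 1#)) * x       ≈⟨ *-congʳ (*-congˡ p×1≈0) ⟩
    ((q ×ᵣ 1#) * 0#) * x              ≈⟨ *-congʳ (zeroʳ _) ⟩
    0# * x                            ≈⟨ zeroˡ x ⟩
    0#                                ∎

  1^n≈1 : ∀ n → 1# ^ n ≈ 1#
  1^n≈1 zero    = refl
  1^n≈1 (suc n) = trans (*-identityˡ _) (1^n≈1 n)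

  0^p≈0 : 0# ^ p ≈ 0#
  0^p≈0 = go p (ℕₚ.<-trans z<s (ℕ.nonTrivial⇒n>1 p {{prime⇒nonTrivial pp}}))
    where
    go : ∀ n → 0 ℕ.< n → 0# ^ n ≈ 0#
    go (suc n) _ = zeroˡ _

  ^p-distrib-+ : ∀ x y → (x + y) ^ p ≈ x ^ p + y ^ p
  ^p-distrib-+ x y = go p ≡.refl
    where
    go : ∀ n → n ≡ p → (x + y) ^ n ≈ x ^ n + y ^ n
    go zero 0≡p = contradiction (≡.sym 0≡p) (ℕ.≢-nonZero⁻¹ p {{prime⇒nonZero pp}})
    go n@(suc n-1) ≡.refl = begin
      (x + y) ^ n                                         ≈⟨ theorem n x y ⟩
      Σ< (suc n) term                                     ≡⟨ ≡.cong (λ k → Σ< k term) (ℕₚ.+-comm 1 n) ⟩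
      Σ< (n ℕ.+ 1) term                                   ≈⟨ Σ<-split n 1 term ⟩
      (term 0 + Σ< n-1 (term ∘ suc)) + (term (n ℕ.+ 0) + 0#)
        ≈⟨ +-cong (+-cong term0 (Σ<-zero n-1 middle)) (trans (+-identityʳ _) termn) ⟩
      (y ^ n + 0#) + x ^ n                                ≈⟨ +-congʳ (+-identityʳ _) ⟩
      y ^ n + x ^ n                                       ≈⟨ +-comm _ _ ⟩
      x ^ n + y ^ n                                       ∎
      where
      term : ℕ → Carrier
      term k = (n C k) ×ᵣ (x ^ k * y ^ (n ∸ k))
      term0 : term 0 ≈ y ^ n
      term0 = trans (+-identityʳ _) (*-identityˡ _)
      termn : term (n ℕ.+ 0) ≈ x ^ n
      termn rewrite ℕₚ.+-identityʳ n-1 | nCn≡1 n | ℕₚ.n∸n≡0 n-1 = trans (+-identityʳ _) (*-identityʳ _)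
      middle : ∀ i → i ℕ.< n-1 → term (suc i) ≈ 0#
      middle i i<n-1 = p∣⇒×≈0 (prime∣C pp z<s (s<s i<n-1)) _

  ⟦_⟧ : ℕ → Carrier
  ⟦ n ⟧ = n ×ᵣ 1#

  -- Fermat's little theorem inside `R`, by induction from the additivity of the p-th power.
  ⟦⟧^p : ∀ n → ⟦ n ⟧ ^ p ≈ ⟦ n ⟧
  ⟦⟧^p zero    = 0^p≈0
  ⟦⟧^p (suc n) = trans (^p-distrib-+ 1# ⟦ n ⟧) (+-cong (1^n≈1 p) (⟦⟧^p n))

  eval : RawPoly → Carrier → Carrier
  eval []      y = 0#
  eval (a ∷ f) y = ⟦ a ⟧ + y * eval f y

  eval-cong : ∀ f {x y} → x ≈ y → eval f x ≈ eval f y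
  eval-cong []      x≈y = refl
  eval-cong (a ∷ f) x≈y = +-congˡ (*-cong x≈y (eval-cong f x≈y))

  eval-^p : ∀ f y → eval f y ^ p ≈ eval f (y ^ p)
  eval-^p []      y = 0^p≈0
  eval-^p (a ∷ f) y = begin
    (⟦ a ⟧ + y * eval f y) ^ p          ≈⟨ ^p-distrib-+ _ _ ⟩
    ⟦ a ⟧ ^ p + (y * eval f y) ^ p      ≈⟨ +-cong (⟦⟧^p a) (^-distrib-* y _ p) ⟩
    ⟦ a ⟧ + y ^ p * eval f y ^ p        ≈⟨ +-congˡ (*-congˡ (eval-^p f y)) ⟩
    ⟦ a ⟧ + y ^ p * eval f (y ^ p)      ∎

  -- Frobenius fixes the coefficients, hence permits passing from a root to its p-th power. This is
  -- the only source of further roots, and it needs no field.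
  eval-root-^p^ : ∀ f y → eval f y ≈ 0# → ∀ i → eval f (y ^ (p ℕ.^ i)) ≈ 0#
  eval-root-^p^ f y fy≈0 zero    = trans (eval-cong f (*-identityʳ y)) fy≈0
  eval-root-^p^ f y fy≈0 (suc i) = begin
    eval f (y ^ (p ℕ.* p ℕ.^ i))     ≡⟨ ≡.cong (λ k → eval f (y ^ k)) (ℕₚ.*-comm p _) ⟩
    eval f (y ^ (p ℕ.^ i ℕ.* p))     ≈⟨ eval-cong f (^-assocʳ y (p ℕ.^ i) p) ⟨
    eval f ((y ^ (p ℕ.^ i)) ^ p)     ≈⟨ eval-^p f _ ⟨
    eval f (y ^ (p ℕ.^ i)) ^ p       ≈⟨ ^-congˡ p (eval-root-^p^ f y fy≈0 i) ⟩
    0# ^ p                           ≈⟨ 0^p≈0 ⟩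
    0#                               ∎

  -- A raw list may be longer than its degree suggests, or shorter than `N`. Entries beyond `N` are
  -- multiples of p and vanish in `R`, while `coeff` supplies zeros past the end.
  eval≈Σ : ∀ f y N → (∀ i → N ℕ.≤ i → p ∣ coeff f i) → eval f y ≈ Σ< N (λ i → ⟦ coeff f i ⟧ * y ^ i)
  eval≈Σ []      y N       N≤ = sym (Σ<-zero N (λ i _ → zeroˡ (y ^ i)))
  eval≈Σ (a ∷ f) y zero    N≤ = begin
    ⟦ a ⟧ + y * eval f y  ≈⟨ +-cong (p∣⇒×≈0 (N≤ 0 z≤n) 1#) (*-congˡ (eval≈Σ f y 0 (λ i _ → N≤ (suc i) z≤n))) ⟩
    0# + y * 0#           ≈⟨ +-identityˡ _ ⟩
    y * 0#                ≈⟨ zeroʳ y ⟩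
    0#                    ∎
  eval≈Σ (a ∷ f) y (suc N) N≤ = +-cong (sym (*-identityʳ _)) (begin
    y * eval f y                                    ≈⟨ *-congˡ (eval≈Σ f y N (λ i N≤i → N≤ (suc i) (s≤s N≤i))) ⟩
    y * Σ< N (λ i → ⟦ coeff f i ⟧ * y ^ i)          ≈⟨ *-distribˡ-Σ< N y (λ i → ⟦ coeff f i ⟧ * y ^ i) ⟩
    Σ< N (λ i → y * (⟦ coeff f i ⟧ * y ^ i))        ≈⟨ Σ<-cong N (λ i _ → exchange y ⟦ coeff f i ⟧ (y ^ i)) ⟩
    Σ< N (λ i → ⟦ coeff f i ⟧ * (y * y ^ i))        ∎)
    where
    open NatSolver R using (solve; _:*_; _:=_)
    exchange : ∀ x y z → x * (y * z) ≈ y * (x * z)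
    exchange = solve 3 (λ x y z → x :* (y :* z) := y :* (x :* z)) refl

-- Units modulo 3, and p as a primitive root modulo powers of 3.

-- Being prime to 3 is recorded as the square being 1 modulo 3. The witness shows that v is its own
-- inverse modulo 3, and closure properties become polynomial identities.
record Unit3 (v : ℕ) : Set where
  constructor _,_
  field
    quotient : ℕ
    v²≡1+3w  : v ℕ.* v ≡ 1 ℕ.+ 3 ℕ.* quotient

unit3-1+3* : ∀ q → Unit3 (1 ℕ.+ 3 ℕ.* q)
unit3-1+3* q = 2 ℕ.* q ℕ.+ 3 ℕ.* (q ℕ.* q) ,
  solve 1 (λ q → (con 1 :+ con 3 :* q) :* (con 1 :+ con 3 :* q) := con 1 :+ con 3 :* (con 2 :* q :+ con 3 :* (q :* q))) ≡.refl q
  where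
  open +-*-Solver

unit3-2+3* : ∀ q → Unit3 (2 ℕ.+ 3 ℕ.* q)
unit3-2+3* q = 1 ℕ.+ 4 ℕ.* q ℕ.+ 3 ℕ.* (q ℕ.* q) ,
  solve 1 (λ q → (con 2 :+ con 3 :* q) :* (con 2 :+ con 3 :* q) := con 1 :+ con 3 :* (con 1 :+ con 4 :* q :+ con 3 :* (q :* q))) ≡.refl q
  where
  open +-*-Solver

unit3-* : ∀ {u v} → Unit3 u → Unit3 v → Unit3 (u ℕ.* v)
unit3-* {u} {v} (w , u²) (x , v²) = w ℕ.+ x ℕ.+ 3 ℕ.* (w ℕ.* x) , (begin
  u ℕ.* v ℕ.* (u ℕ.* v)                      ≡⟨ solve 2 (λ u v → u :* v :* (u :* v) := u :* u :* (v :* v)) ≡.refl u v ⟩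
  u ℕ.* u ℕ.* (v ℕ.* v)                      ≡⟨ ≡.cong₂ ℕ._*_ u² v² ⟩
  (1 ℕ.+ 3 ℕ.* w) ℕ.* (1 ℕ.+ 3 ℕ.* x)        ≡⟨ solve 2 (λ w x → (con 1 :+ con 3 :* w) :* (con 1 :+ con 3 :* x) := con 1 :+ con 3 :* (w :+ x :+ con 3 :* (w :* x))) ≡.refl w x ⟩
  1 ℕ.+ 3 ℕ.* (w ℕ.+ x ℕ.+ 3 ℕ.* (w ℕ.* x))  ∎)
  where
  open +-*-Solver
  open ≡.≡-Reasoning

unit3-^ : ∀ {u} → Unit3 u → ∀ i → Unit3 (u ℕ.^ i)
unit3-^ U zero    = 0 , ≡.refl
unit3-^ U (suc i) = unit3-* U (unit3-^ U i)

unit3-+3* : ∀ {u} → Unit3 u → ∀ x → Unit3 (u ℕ.+ 3 ℕ.* x)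
unit3-+3* {u} (w , u²) x = w ℕ.+ 2 ℕ.* (u ℕ.* x) ℕ.+ 3 ℕ.* (x ℕ.* x) , (begin
  (u ℕ.+ 3 ℕ.* x) ℕ.* (u ℕ.+ 3 ℕ.* x)  ≡⟨ solve 2 (λ u x → (u :+ con 3 :* x) :* (u :+ con 3 :* x) := u :* u :+ con 3 :* (con 2 :* (u :* x) :+ con 3 :* (x :* x))) ≡.refl u x ⟩
  u ℕ.* u ℕ.+ 3 ℕ.* (2 ℕ.* (u ℕ.* x) ℕ.+ 3 ℕ.* (x ℕ.* x))  ≡⟨ ≡.cong (ℕ._+ 3 ℕ.* (2 ℕ.* (u ℕ.* x) ℕ.+ 3 ℕ.* (x ℕ.* x))) u² ⟩
  1 ℕ.+ 3 ℕ.* w ℕ.+ 3 ℕ.* (2 ℕ.* (u ℕ.* x) ℕ.+ 3 ℕ.* (x ℕ.* x))  ≡⟨ solve 3 (λ u x w → con 1 :+ con 3 :* w :+ con 3 :* (con 2 :* (u :* x) :+ con 3 :* (x :* x)) := con 1 :+ con 3 :* (w :+ con 2 :* (u :* x) :+ con 3 :* (x :* x))) ≡.refl u x w ⟩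
  1 ℕ.+ 3 ℕ.* (w ℕ.+ 2 ℕ.* (u ℕ.* x) ℕ.+ 3 ℕ.* (x ℕ.* x)) ∎)
  where
  open +-*-Solver
  open ≡.≡-Reasoning

%9⇒2+3q : ∀ p → p % 9 ≡ 2 ⊎ p % 9 ≡ 5 → ∃ λ q → p ≡ 2 ℕ.+ 3 ℕ.* q
%9⇒2+3q p p%9 with p%9
... | inj₁ p%9≡2 = p / 9 ℕ.* 3 , ≡.trans (m≡m%n+[m/n]*n p 9) (≡.cong₂ ℕ._+_ p%9≡2
      (solve 1 (λ q → q :* con 9 := con 3 :* (q :* con 3)) ≡.refl (p / 9)))
  where
  open +-*-Solver
... | inj₂ p%9≡5 = 1 ℕ.+ p / 9 ℕ.* 3 , ≡.trans (m≡m%n+[m/n]*n p 9) (≡.trans (≡.cong₂ ℕ._+_ p%9≡5 ≡.refl)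
      (solve 1 (λ q → con 5 :+ q :* con 9 := con 2 :+ con 3 :* (con 1 :+ q :* con 3)) ≡.refl (p / 9)))
  where
  open +-*-Solver

-- The residue modulo 9 counts here: p^2 is 4 or 7 modulo 9, so 3 divides p^2 - 1 exactly once. The
-- remaining class p = 8 of those congruent to 2 modulo 3 would give p^2 = 1 modulo 9.
%9⇒²≡1+3u : ∀ p → p % 9 ≡ 2 ⊎ p % 9 ≡ 5 → ∃ λ u → p ℕ.* p ≡ 1 ℕ.+ 3 ℕ.* u × Unit3 u
%9⇒²≡1+3u p p%9 with p%9
... | inj₁ p%9≡2 = 1 ℕ.+ 3 ℕ.* (4 ℕ.* q ℕ.+ 9 ℕ.* (q ℕ.* q)) , eq , unit3-1+3* (4 ℕ.* q ℕ.+ 9 ℕ.* (q ℕ.* q))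
  where
  open +-*-Solver
  q = p / 9
  p≡ : p ≡ 2 ℕ.+ q ℕ.* 9
  p≡ = ≡.trans (m≡m%n+[m/n]*n p 9) (≡.cong (ℕ._+ q ℕ.* 9) p%9≡2)
  eq = ≡.trans (≡.cong₂ ℕ._*_ p≡ p≡)
    (solve 1 (λ q → (con 2 :+ q :* con 9) :* (con 2 :+ q :* con 9) := con 1 :+ con 3 :* (con 1 :+ con 3 :* (con 4 :* q :+ con 9 :* (q :* q)))) ≡.refl q)
... | inj₂ p%9≡5 = 2 ℕ.+ 3 ℕ.* (2 ℕ.+ 10 ℕ.* q ℕ.+ 9 ℕ.* (q ℕ.* q)) , eq , unit3-2+3* (2 ℕ.+ 10 ℕ.* q ℕ.+ 9 ℕ.* (q ℕ.* q))
  where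
  open +-*-Solver
  q = p / 9
  p≡ : p ≡ 5 ℕ.+ q ℕ.* 9
  p≡ = ≡.trans (m≡m%n+[m/n]*n p 9) (≡.cong (ℕ._+ q ℕ.* 9) p%9≡5)
  eq = ≡.trans (≡.cong₂ ℕ._*_ p≡ p≡)
    (solve 1 (λ q → (con 5 :+ q :* con 9) :* (con 5 :+ q :* con 9) := con 1 :+ con 3 :* (con 2 :+ con 3 :* (con 2 :+ con 10 :* q :+ con 9 :* (q :* q)))) ≡.refl q)

module PrimitiveRoot (p : ℕ) (p%9 : p % 9 ≡ 2 ⊎ p % 9 ≡ 5) where

  p-unit3 : Unit3 p
  p-unit3 with %9⇒2+3q p p%9
  ... | q , ≡.refl = unit3-2+3* q

  -- The lifting-the-exponent step: cubing multiplies p^e - 1 by exactly 3.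
  p^e≡1+3^ku : ∀ k → ∃₂ λ e u → p ℕ.^ e ≡ 1 ℕ.+ 3 ℕ.^ suc k ℕ.* u × Unit3 u
  p^e≡1+3^ku zero with %9⇒²≡1+3u p p%9
  ... | u , eq , U = 2 , u , ≡.trans (≡.cong (p ℕ.*_) (ℕₚ.*-identityʳ p)) eq , U
  p^e≡1+3^ku (suc k) with p^e≡1+3^ku k
  ... | e , u , eq , U = e ℕ.* 3 , u ℕ.+ 3 ℕ.* x , (begin
      p ℕ.^ (e ℕ.* 3)              ≡⟨ ℕₚ.^-*-assoc p e 3 ⟨
      (p ℕ.^ e) ℕ.^ 3              ≡⟨ ≡.cong (ℕ._^ 3) eq ⟩
      (1 ℕ.+ 3 ℕ.* t ℕ.* u) ℕ.^ 3  ≡⟨ solve 2 (λ t u → (con 1 :+ con 3 :* t :* u) :^ 3 := con 1 :+ con 3 :* (con 3 :* t) :* (u :+ con 3 :* (t :* u :* u :+ t :* t :* u :* u :* u))) ≡.refl t u ⟩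
      1 ℕ.+ 3 ℕ.* (3 ℕ.* t) ℕ.* (u ℕ.+ 3 ℕ.* x) ∎) , unit3-+3* U x
    where
    open +-*-Solver
    open ≡.≡-Reasoning
    t = 3 ℕ.^ k
    x = t ℕ.* u ℕ.* u ℕ.+ t ℕ.* t ℕ.* u ℕ.* u ℕ.* u

  -- The first-order binomial expansion with T = 3t. The square of T is t times 3T, so all higher
  -- terms fall into the multiple of 3T.
  [1+Tu]^n : ∀ t u n → ∃ λ x → (1 ℕ.+ 3 ℕ.* t ℕ.* u) ℕ.^ n ≡ 1 ℕ.+ n ℕ.* u ℕ.* (3 ℕ.* t) ℕ.+ 3 ℕ.* (3 ℕ.* t) ℕ.* x
  [1+Tu]^n t u zero    = 0 , solve 1 (λ t → con 1 := con 1 :+ con 3 :* (con 3 :* t) :* con 0) ≡.refl t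
    where
    open +-*-Solver
  [1+Tu]^n t u (suc n) with [1+Tu]^n t u n
  ... | x , eq = x ℕ.+ t ℕ.* u ℕ.* n ℕ.* u ℕ.+ 3 ℕ.* t ℕ.* u ℕ.* x , ≡.trans (≡.cong ((1 ℕ.+ 3 ℕ.* t ℕ.* u) ℕ.*_) eq)
      (solve 4 (λ t u n x → (con 1 :+ con 3 :* t :* u) :* (con 1 :+ n :* u :* (con 3 :* t) :+ con 3 :* (con 3 :* t) :* x)
                         := con 1 :+ (con 1 :+ n) :* u :* (con 3 :* t) :+ con 3 :* (con 3 :* t) :* (x :+ t :* u :* n :* u :+ con 3 :* t :* u :* x)) ≡.refl t u n x)
    where
    open +-*-Solver

  -- Congruence modulo 3^k is written with multiples on both sides to avoid subtraction. In the
  -- lifting step from T to 3T, p^i differs from j by a multiple of T; multiplying by the n-th power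
  -- of p^e = 1 + Tu changes it by p^i n u T modulo 3T. Since p^i u is prime to 3, some n removes
  -- the difference.
  generates : ∀ k j → Unit3 j → ∃ λ i → ∃₂ λ a b → p ℕ.^ i ℕ.+ a ℕ.* 3 ℕ.^ k ≡ j ℕ.+ b ℕ.* 3 ℕ.^ k
  generates zero j U = 0 , j , 1 , solve 1 (λ j → con 1 :+ j :* con 1 := j :+ con 1 :* con 1) ≡.refl j
    where
    open +-*-Solver
  -- Lifting can start only at modulus 3, the smallest power T of 3 whose square is divisible by 3T.
  -- Here the powers 1 and p represent the residues 1 and 2.
  generates (suc zero) j (w , j²) with residue3 j
  ... | inj₁ (q , ≡.refl) with () ← ∣.∣1⇒≡1 (∣.∣m+n∣m⇒∣n (≡.subst (3 ∣_) (≡.trans j² (ℕₚ.+-comm 1 (3 ℕ.* w))) (∣.∣m⇒∣m*n (3 ℕ.* q) (∣.m∣m*n q))) (∣.m∣m*n w))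
  generates (suc zero) j (w , j²) | inj₂ (inj₁ (q , ≡.refl)) = 0 , q , 0 , solve 1 (λ q → con 1 :+ q :* con 3 := con 1 :+ con 3 :* q :+ con 0) ≡.refl q
    where
    open +-*-Solver
  generates (suc zero) j (w , j²) | inj₂ (inj₂ (q , ≡.refl)) with %9⇒2+3q p p%9
  ... | r , p≡ = 1 , q , r , ≡.trans (≡.cong (λ p → p ℕ.^ 1 ℕ.+ q ℕ.* 3) p≡)
      (solve 2 (λ q r → (con 2 :+ con 3 :* r) :* con 1 :+ q :* con 3 := con 2 :+ con 3 :* q :+ r :* con 3) ≡.refl q r)
    where
    open +-*-Solver
  generates (suc (suc k)) j U with generates (suc k) j U | p^e≡1+3^ku k
  ... | i , a , b , eq | e , u , p^e , Uu with unit3-* (unit3-^ p-unit3 i) Uu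
  ...   | w , v² with [1+Tu]^n (3 ℕ.^ k) u (p ℕ.^ i ℕ.* u ℕ.* (a ℕ.+ 2 ℕ.* b))
  ...     | x , eqx = i ℕ.+ e ℕ.* n , 0 , y , ℕₚ.+-cancelʳ-≡ (b ℕ.* T) _ _ (begin
      p ℕ.^ (i ℕ.+ e ℕ.* n) ℕ.+ 0 ℕ.+ b ℕ.* T                ≡⟨ ≡.cong (λ z → z ℕ.+ 0 ℕ.+ b ℕ.* T) (≡.trans (ℕₚ.^-distribˡ-+-* p i (e ℕ.* n)) (≡.cong (P ℕ.*_) (≡.sym (ℕₚ.^-*-assoc p e n)))) ⟩
      P ℕ.* (p ℕ.^ e) ℕ.^ n ℕ.+ 0 ℕ.+ b ℕ.* T                ≡⟨ ≡.cong (λ z → P ℕ.* z ℕ.^ n ℕ.+ 0 ℕ.+ b ℕ.* T) p^e ⟩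
      P ℕ.* (1 ℕ.+ T ℕ.* u) ℕ.^ n ℕ.+ 0 ℕ.+ b ℕ.* T          ≡⟨ ≡.cong (λ z → P ℕ.* z ℕ.+ 0 ℕ.+ b ℕ.* T) eqx ⟩
      P ℕ.* (1 ℕ.+ P ℕ.* u ℕ.* c ℕ.* u ℕ.* T ℕ.+ 3 ℕ.* T ℕ.* x) ℕ.+ 0 ℕ.+ b ℕ.* T
        ≡⟨ solve 6 (λ P u c T x b → P :* (con 1 :+ P :* u :* c :* u :* T :+ con 3 :* T :* x) :+ con 0 :+ b :* T
                := P :+ P :* u :* (P :* u) :* c :* T :+ con 3 :* T :* (P :* x) :+ b :* T) ≡.refl P u c T x b ⟩
      P ℕ.+ P ℕ.* u ℕ.* (P ℕ.* u) ℕ.* c ℕ.* T ℕ.+ 3 ℕ.* T ℕ.* (P ℕ.* x) ℕ.+ b ℕ.* T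
        ≡⟨ ≡.cong (λ z → P ℕ.+ z ℕ.* c ℕ.* T ℕ.+ 3 ℕ.* T ℕ.* (P ℕ.* x) ℕ.+ b ℕ.* T) v² ⟩
      P ℕ.+ (1 ℕ.+ 3 ℕ.* w) ℕ.* c ℕ.* T ℕ.+ 3 ℕ.* T ℕ.* (P ℕ.* x) ℕ.+ b ℕ.* T
        ≡⟨ solve 6 (λ P w a b T x → P :+ (con 1 :+ con 3 :* w) :* (a :+ con 2 :* b) :* T :+ con 3 :* T :* (P :* x) :+ b :* T
                := (P :+ a :* T) :+ con 3 :* T :* (w :* (a :+ con 2 :* b) :+ b :+ P :* x)) ≡.refl P w a b T x ⟩
      (P ℕ.+ a ℕ.* T) ℕ.+ 3 ℕ.* T ℕ.* (w ℕ.* c ℕ.+ b ℕ.+ P ℕ.* x)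
        ≡⟨ ≡.cong (ℕ._+ 3 ℕ.* T ℕ.* (w ℕ.* c ℕ.+ b ℕ.+ P ℕ.* x)) eq ⟩
      (j ℕ.+ b ℕ.* T) ℕ.+ 3 ℕ.* T ℕ.* (w ℕ.* c ℕ.+ b ℕ.+ P ℕ.* x)
        ≡⟨ solve 4 (λ j b T y → (j :+ b :* T) :+ con 3 :* T :* y := j :+ y :* (con 3 :* T) :+ b :* T) ≡.refl j b T y ⟩
      j ℕ.+ y ℕ.* (3 ℕ.* T) ℕ.+ b ℕ.* T ∎)
    where
    open +-*-Solver
    open ≡.≡-Reasoning
    P = p ℕ.^ i
    T = 3 ℕ.^ suc k
    -- By `eq`, j = P + (a - b)T, so P n u must be a - b modulo 3. The number `c` stands for a - b,
    -- with 2b in place of -b, and P u is its own inverse modulo 3, hence n = P u c. In the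
    -- computation b T is added on both sides so that `eq` applies.
    c = a ℕ.+ 2 ℕ.* b
    n = P ℕ.* u ℕ.* c
    y = w ℕ.* c ℕ.+ b ℕ.+ P ℕ.* x

-- The trace argument in a commutative semiring of characteristic p.

module Trace {a ℓ} (R : CommutativeSemiring a ℓ) (p : ℕ) (pp : Prime p) (p%9 : p % 9 ≡ 2 ⊎ p % 9 ≡ 5)
  (p×1≈0 : VanishesIn R p) where

  open CommutativeSemiring R hiding (zero)
  open SemiringMult semiring renaming (_×_ to _×ᵣ_)
  open Sums R
  open Frobenius R p pp p×1≈0
  open import Algebra.Properties.CommutativeSemiring.Exp R
  open import Relation.Binary.Reasoning.Setoid setoid
  open NatSolver R using (solve; _:*_; _:+_; _:=_; con)

  -- The cyclotomic relation is required rather than order 3: with zero divisors, `ω ^ 3 ≈ 1#` and ω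
  -- being different from 1 would not imply it.
  PrimitiveCubeRoot : Carrier → Set ℓ
  PrimitiveCubeRoot ω = 1# + ω + ω * ω ≈ 0#

  ω^3≈1 : ∀ {ω} → PrimitiveCubeRoot ω → ω ^ 3 ≈ 1#
  ω^3≈1 {ω} eq = begin
    ω * (ω * (ω * 1#))                    ≈⟨ trans (*-congˡ (*-congˡ (*-identityʳ ω))) (sym (+-identityʳ _)) ⟩
    ω * (ω * ω) + 0#                      ≈⟨ +-congˡ eq ⟨
    ω * (ω * ω) + (1# + ω + ω * ω)        ≈⟨ solve 1 (λ ω → ω :* (ω :* ω) :+ (con 1 :+ ω :+ ω :* ω) := con 1 :+ ω :* (con 1 :+ ω :+ ω :* ω)) refl ω ⟩
    1# + ω * (1# + ω + ω * ω)             ≈⟨ +-congˡ (trans (*-congˡ eq) (zeroʳ ω)) ⟩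
    1# + 0#                               ≈⟨ +-identityʳ 1# ⟩
    1#                                    ∎

  ^-3q : ∀ {ω} → PrimitiveCubeRoot ω → ∀ q → ω ^ (3 ℕ.* q) ≈ 1#
  ^-3q {ω} eq q = trans (sym (^-assocʳ ω 3 q)) (trans (^-congˡ q (ω^3≈1 eq)) (1^n≈1 q))

  ^-r+3q : ∀ {ω} → PrimitiveCubeRoot ω → ∀ r q → ω ^ (r ℕ.+ 3 ℕ.* q) ≈ ω ^ r
  ^-r+3q {ω} eq r q = trans (^-homo-* ω r (3 ℕ.* q)) (trans (*-congˡ (^-3q eq q)) (*-identityʳ _))

  primitiveCubeRoot-cong : ∀ {x y} → x ≈ y → PrimitiveCubeRoot x → PrimitiveCubeRoot y
  primitiveCubeRoot-cong x≈y eq = trans (sym (+-cong (+-congˡ x≈y) (*-cong x≈y x≈y))) eq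

  primitiveCubeRoot-² : ∀ {ω} → PrimitiveCubeRoot ω → PrimitiveCubeRoot (ω ^ 2)
  primitiveCubeRoot-² {ω} eq = begin
    1# + ω ^ 2 + ω ^ 2 * ω ^ 2   ≈⟨ +-cong (+-congˡ (*-congˡ (*-identityʳ ω))) (trans (sym (^-homo-* ω 2 2)) (^-r+3q eq 1 1)) ⟩
    1# + ω * ω + ω * 1#          ≈⟨ solve 1 (λ ω → con 1 :+ ω :* ω :+ ω :* con 1 := con 1 :+ ω :+ ω :* ω) refl ω ⟩
    1# + ω + ω * ω               ≈⟨ eq ⟩
    0#                           ∎

  geometric : ℕ → Carrier → Carrier
  geometric n y = Σ< n (λ i → y ^ i)

  geometric-cong : ∀ n {x y} → x ≈ y → geometric n x ≈ geometric n y
  geometric-cong n x≈y = Σ<-cong n (λ i _ → ^-congˡ i x≈y)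

  geometric-1 : ∀ n {y} → y ≈ 1# → geometric n y ≈ ⟦ n ⟧
  geometric-1 n y≈1 = trans (Σ<-cong n (λ i _ → trans (^-congˡ i y≈1) (1^n≈1 i))) (Σ<-const n 1#)

  geometric-+ : ∀ m n y → geometric (m ℕ.+ n) y ≈ geometric m y + y ^ m * geometric n y
  geometric-+ m n y = trans (Σ<-split m n (y ^_)) (+-congˡ (trans (Σ<-cong n (λ i _ → ^-homo-* y m i)) (sym (*-distribˡ-Σ< n (y ^ m) (y ^_)))))

  geometric-3* : ∀ n y → geometric (3 ℕ.* n) y ≈ (1# + y ^ n + y ^ n * y ^ n) * geometric n y
  geometric-3* n y = begin
    geometric (n ℕ.+ (n ℕ.+ (n ℕ.+ 0))) y  ≈⟨ geometric-+ n (n ℕ.+ (n ℕ.+ 0)) y ⟩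
    g + z * geometric (n ℕ.+ (n ℕ.+ 0)) y  ≈⟨ +-congˡ (*-congˡ (geometric-+ n (n ℕ.+ 0) y)) ⟩
    g + z * (g + z * geometric (n ℕ.+ 0) y) ≡⟨ ≡.cong (λ k → g + z * (g + z * geometric k y)) (ℕₚ.+-identityʳ n) ⟩
    g + z * (g + z * g)                    ≈⟨ solve 2 (λ g z → g :+ z :* (g :+ z :* g) := (con 1 :+ z :+ z :* z) :* g) refl g z ⟩
    (1# + z + z * z) * g                   ∎
    where
    g = geometric n y
    z = y ^ n

  -- Multiplying the sum by 1 - y and cancelling is impossible with zero divisors. Instead the sum
  -- of length 3N is split by `geometric-3*`. With y = ζ^(3m), y^N is the m-th power of the cube
  -- root of unity, so the first factor vanishes unless 3 divides m; in that case the second factor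
  -- vanishes by induction with ζ^3 in place of ζ.
  geometric-vanishes : ∀ k m ζ → PrimitiveCubeRoot (ζ ^ (3 ℕ.^ k)) → ¬ 3 ℕ.^ k ∣ m → geometric (3 ℕ.^ k) (ζ ^ (3 ℕ.* m)) ≈ 0#
  geometric-vanishes zero    m ζ ω 1∤m = contradiction (∣.1∣ m) 1∤m
  geometric-vanishes (suc k) m ζ ω 3^k∤m = trans (geometric-3* N (ζ ^ (3 ℕ.* m))) (cases (residue3 m))
    where
    N = 3 ℕ.^ k
    exponents : (ζ ^ (3 ℕ.* m)) ^ N ≈ (ζ ^ (3 ℕ.* N)) ^ m
    exponents = begin
      (ζ ^ (3 ℕ.* m)) ^ N   ≈⟨ ^-assocʳ ζ (3 ℕ.* m) N ⟩
      ζ ^ (3 ℕ.* m ℕ.* N)   ≡⟨ ≡.cong (ζ ^_) (≡.trans (ℕₚ.*-assoc 3 m N) (≡.trans (≡.cong (3 ℕ.*_) (ℕₚ.*-comm m N)) (≡.sym (ℕₚ.*-assoc 3 N m)))) ⟩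
      ζ ^ (3 ℕ.* N ℕ.* m)   ≈⟨ ^-assocʳ ζ (3 ℕ.* N) m ⟨
      (ζ ^ (3 ℕ.* N)) ^ m   ∎
    root : ∀ {x} → (ζ ^ (3 ℕ.* N)) ^ m ≈ x → PrimitiveCubeRoot x → (1# + (ζ ^ (3 ℕ.* m)) ^ N + (ζ ^ (3 ℕ.* m)) ^ N * (ζ ^ (3 ℕ.* m)) ^ N) * geometric N (ζ ^ (3 ℕ.* m)) ≈ 0#
    root eq cube = trans (*-congʳ (primitiveCubeRoot-cong (sym (trans exponents eq)) cube)) (zeroˡ _)
    cases : _ → _
    cases (inj₁ (q , ≡.refl)) = trans (*-congˡ (trans
      (geometric-cong N (sym (^-assocʳ ζ 3 (3 ℕ.* q))))
      (geometric-vanishes k q (ζ ^ 3) (primitiveCubeRoot-cong (sym (^-assocʳ ζ 3 N)) ω) (λ N∣q → 3^k∤m (∣.*-monoʳ-∣ 3 N∣q))))) (zeroʳ _)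
    cases (inj₂ (inj₁ (q , ≡.refl))) = root (trans (^-r+3q ω 1 q) (*-identityʳ _)) ω
    cases (inj₂ (inj₂ (q , ≡.refl))) = root (^-r+3q ω 2 q) (primitiveCubeRoot-² ω)

  module Root (k : ℕ) (ζ : Carrier) (ω : PrimitiveCubeRoot (ζ ^ (3 ℕ.^ k)))
              (f : RawPoly) (fζ≈0 : eval f ζ ≈ 0#) where

    n : ℕ
    n = 3 ℕ.^ k

    -- Since ζ^(3n) is 1, exponents of ζ count only modulo 3n = 3^(k+1), and there j is a power of
    -- p.
    eval-conjugate : ∀ j → Unit3 j → eval f (ζ ^ j) ≈ 0#
    eval-conjugate j U with PrimitiveRoot.generates p p%9 (suc k) j U
    ... | i , a , b , eq = trans (eval-cong f (begin
        ζ ^ j                                ≈⟨ period j b ⟨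
        ζ ^ (j ℕ.+ b ℕ.* (3 ℕ.* n))          ≡⟨ ≡.cong (ζ ^_) eq ⟨
        ζ ^ (p ℕ.^ i ℕ.+ a ℕ.* (3 ℕ.* n))    ≈⟨ period (p ℕ.^ i) a ⟩
        ζ ^ (p ℕ.^ i)                        ∎)) (eval-root-^p^ f ζ fζ≈0 i)
      where
      period : ∀ j b → ζ ^ (j ℕ.+ b ℕ.* (3 ℕ.* n)) ≈ ζ ^ j
      period j b = begin
        ζ ^ (j ℕ.+ b ℕ.* (3 ℕ.* n))        ≈⟨ ^-homo-* ζ j _ ⟩
        ζ ^ j * ζ ^ (b ℕ.* (3 ℕ.* n))      ≡⟨ ≡.cong (λ e → ζ ^ j * ζ ^ e) (ℕsolve b n) ⟩
        ζ ^ j * ζ ^ (n ℕ.* (3 ℕ.* b))      ≈⟨ *-congˡ (^-assocʳ ζ n (3 ℕ.* b)) ⟨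
        ζ ^ j * (ζ ^ n) ^ (3 ℕ.* b)        ≈⟨ *-congˡ (^-3q ω b) ⟩
        ζ ^ j * 1#                         ≈⟨ *-identityʳ _ ⟩
        ζ ^ j                              ∎
        where
        ℕsolve : ∀ b n → b ℕ.* (3 ℕ.* n) ≡ n ℕ.* (3 ℕ.* b)
        ℕsolve = S.solve 2 (λ b n → b S.:* (S.con 3 S.:* n) S.:= n S.:* (S.con 3 S.:* b)) ≡.refl
          where
          module S = +-*-Solver

    -- The trace of ζ^m: the sum of ζ^{mj} over the residues j mod 3n prime to 3.
    trace : ℕ → Carrier
    trace m = (ζ ^ m + ζ ^ (m ℕ.+ m)) * geometric n (ζ ^ (3 ℕ.* m))

    trace-vanishes : ∀ m → ¬ n ∣ m → trace m ≈ 0#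
    trace-vanishes m n∤m = trans (*-congˡ (geometric-vanishes k m ζ ω n∤m)) (zeroʳ _)

    -- With ω = ζ^n this is 2n when 3 divides t and -n otherwise. The value -n stays in the form (ω
    -- + ω^2) n, since no subtraction is available.
    trace-multiple : ∀ t → trace (n ℕ.* t) ≈ ((ζ ^ n) ^ t + (ζ ^ n) ^ (2 ℕ.* t)) * ⟦ n ⟧
    trace-multiple t = *-cong (+-cong (sym (^-assocʳ ζ n t)) (trans (reflexive (≡.cong (ζ ^_) e₁)) (sym (^-assocʳ ζ n (2 ℕ.* t)))))
      (geometric-1 n (trans (reflexive (≡.cong (ζ ^_) e₂)) (trans (sym (^-assocʳ ζ n (3 ℕ.* t))) (^-3q ω t))))
      where
      module S = +-*-Solver
      e₁ : n ℕ.* t ℕ.+ n ℕ.* t ≡ n ℕ.* (2 ℕ.* t)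
      e₁ = S.solve 2 (λ n t → n S.:* t S.:+ n S.:* t S.:= n S.:* (S.con 2 S.:* t)) ≡.refl n t
      e₂ : 3 ℕ.* (n ℕ.* t) ≡ n ℕ.* (3 ℕ.* t)
      e₂ = S.solve 2 (λ n t → S.con 3 S.:* (n S.:* t) S.:= n S.:* (S.con 3 S.:* t)) ≡.refl n t

    module _ (f<2n : ∀ i → n ℕ.+ n ℕ.≤ i → p ∣ coeff f i) where

      -- Unfolding the trace and exchanging the summations gives the sum of ζ^(sj) f(ζ^j) over j = 1
      -- + 3i and j = 2 + 3i with i < n. Each of these terms is zero by `eval-conjugate`.
      trace-relation : ∀ s → Σ< (n ℕ.+ n) (λ l → ⟦ coeff f l ⟧ * trace (s ℕ.+ l)) ≈ 0#
      trace-relation s = begin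
        Σ< (n ℕ.+ n) (λ l → ⟦ coeff f l ⟧ * trace (s ℕ.+ l))
          ≈⟨ Σ<-cong (n ℕ.+ n) (λ l _ → trans (sym (*-assoc _ _ _)) (*-distribˡ-Σ< n (⟦ coeff f l ⟧ * (ζ ^ (s ℕ.+ l) + ζ ^ (s ℕ.+ l ℕ.+ (s ℕ.+ l)))) (λ i → (ζ ^ (3 ℕ.* (s ℕ.+ l))) ^ i))) ⟩
        Σ< (n ℕ.+ n) (λ l → Σ< n (λ i → ⟦ coeff f l ⟧ * (ζ ^ (s ℕ.+ l) + ζ ^ (s ℕ.+ l ℕ.+ (s ℕ.+ l))) * (ζ ^ (3 ℕ.* (s ℕ.+ l))) ^ i))
          ≈⟨ Σ<-swap (n ℕ.+ n) n (λ l i → ⟦ coeff f l ⟧ * (ζ ^ (s ℕ.+ l) + ζ ^ (s ℕ.+ l ℕ.+ (s ℕ.+ l))) * (ζ ^ (3 ℕ.* (s ℕ.+ l))) ^ i) ⟩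
        Σ< n (λ i → Σ< (n ℕ.+ n) (λ l → ⟦ coeff f l ⟧ * (ζ ^ (s ℕ.+ l) + ζ ^ (s ℕ.+ l ℕ.+ (s ℕ.+ l))) * (ζ ^ (3 ℕ.* (s ℕ.+ l))) ^ i))
          ≈⟨ Σ<-zero n (λ i _ → trans (Σ<-cong (n ℕ.+ n) (λ l _ → pointwise i l)) (conjugates i)) ⟩
        0# ∎
        where
        conj : ℕ → ℕ → Carrier
        conj j l = ζ ^ (s ℕ.* j) * (⟦ coeff f l ⟧ * (ζ ^ j) ^ l)

        power : ∀ r i l → ζ ^ (s ℕ.* (r ℕ.+ 3 ℕ.* i)) * (ζ ^ (r ℕ.+ 3 ℕ.* i)) ^ l ≈ ζ ^ (r ℕ.* (s ℕ.+ l)) * (ζ ^ (3 ℕ.* (s ℕ.+ l))) ^ i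
        power r i l = begin
          ζ ^ (s ℕ.* (r ℕ.+ 3 ℕ.* i)) * (ζ ^ (r ℕ.+ 3 ℕ.* i)) ^ l   ≈⟨ *-congˡ (^-assocʳ ζ (r ℕ.+ 3 ℕ.* i) l) ⟩
          ζ ^ (s ℕ.* (r ℕ.+ 3 ℕ.* i)) * ζ ^ ((r ℕ.+ 3 ℕ.* i) ℕ.* l) ≈⟨ ^-homo-* ζ (s ℕ.* (r ℕ.+ 3 ℕ.* i)) ((r ℕ.+ 3 ℕ.* i) ℕ.* l) ⟨
          ζ ^ (s ℕ.* (r ℕ.+ 3 ℕ.* i) ℕ.+ (r ℕ.+ 3 ℕ.* i) ℕ.* l)     ≡⟨ ≡.cong (ζ ^_) (S.solve 4 (λ s r i l → s S.:* (r S.:+ S.con 3 S.:* i) S.:+ (r S.:+ S.con 3 S.:* i) S.:* l S.:= r S.:* (s S.:+ l) S.:+ S.con 3 S.:* (s S.:+ l) S.:* i) ≡.refl s r i l) ⟩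
          ζ ^ (r ℕ.* (s ℕ.+ l) ℕ.+ 3 ℕ.* (s ℕ.+ l) ℕ.* i)           ≈⟨ ^-homo-* ζ (r ℕ.* (s ℕ.+ l)) (3 ℕ.* (s ℕ.+ l) ℕ.* i) ⟩
          ζ ^ (r ℕ.* (s ℕ.+ l)) * ζ ^ (3 ℕ.* (s ℕ.+ l) ℕ.* i)       ≈⟨ *-congˡ (^-assocʳ ζ (3 ℕ.* (s ℕ.+ l)) i) ⟨
          ζ ^ (r ℕ.* (s ℕ.+ l)) * (ζ ^ (3 ℕ.* (s ℕ.+ l))) ^ i       ∎
          where
          module S = +-*-Solver

        pointwise : ∀ i l → ⟦ coeff f l ⟧ * (ζ ^ (s ℕ.+ l) + ζ ^ (s ℕ.+ l ℕ.+ (s ℕ.+ l))) * (ζ ^ (3 ℕ.* (s ℕ.+ l))) ^ i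
                            ≈ conj (1 ℕ.+ 3 ℕ.* i) l + conj (2 ℕ.+ 3 ℕ.* i) l
        pointwise i l = begin
          c * (ζ ^ m + ζ ^ (m ℕ.+ m)) * z       ≈⟨ solve 4 (λ c x y z → c :* (x :+ y) :* z := c :* (x :* z) :+ c :* (y :* z)) refl c (ζ ^ m) (ζ ^ (m ℕ.+ m)) z ⟩
          c * (ζ ^ m * z) + c * (ζ ^ (m ℕ.+ m) * z)
            ≡⟨ ≡.cong₂ (λ u v → c * (ζ ^ u * z) + c * (ζ ^ v * z)) (≡.sym (ℕₚ.*-identityˡ m)) (≡.cong (m ℕ.+_) (≡.sym (ℕₚ.*-identityˡ m))) ⟩
          c * (ζ ^ (1 ℕ.* m) * z) + c * (ζ ^ (2 ℕ.* m) * z) ≈⟨ +-cong (*-congˡ (power 1 i l)) (*-congˡ (power 2 i l)) ⟨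
          c * (ζ ^ (s ℕ.* j₁) * (ζ ^ j₁) ^ l) + c * (ζ ^ (s ℕ.* j₂) * (ζ ^ j₂) ^ l)
            ≈⟨ +-cong (exchange c _ _) (exchange c _ _) ⟩
          conj j₁ l + conj j₂ l ∎
          where
          c = ⟦ coeff f l ⟧
          m = s ℕ.+ l
          z = (ζ ^ (3 ℕ.* m)) ^ i
          j₁ = 1 ℕ.+ 3 ℕ.* i
          j₂ = 2 ℕ.+ 3 ℕ.* i
          exchange : ∀ x y z → x * (y * z) ≈ y * (x * z)
          exchange = solve 3 (λ x y z → x :* (y :* z) := y :* (x :* z)) refl

        conjugate : ∀ j → Unit3 j → Σ< (n ℕ.+ n) (conj j) ≈ 0#
        conjugate j U = begin
          Σ< (n ℕ.+ n) (conj j)           ≈⟨ *-distribˡ-Σ< (n ℕ.+ n) (ζ ^ (s ℕ.* j)) (λ l → ⟦ coeff f l ⟧ * (ζ ^ j) ^ l) ⟨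
          ζ ^ (s ℕ.* j) * Σ< (n ℕ.+ n) (λ l → ⟦ coeff f l ⟧ * (ζ ^ j) ^ l) ≈⟨ *-congˡ (eval≈Σ f (ζ ^ j) (n ℕ.+ n) f<2n) ⟨
          ζ ^ (s ℕ.* j) * eval f (ζ ^ j)  ≈⟨ *-congˡ (eval-conjugate j U) ⟩
          ζ ^ (s ℕ.* j) * 0#              ≈⟨ zeroʳ _ ⟩
          0#                              ∎

        conjugates : ∀ i → Σ< (n ℕ.+ n) (λ l → conj (1 ℕ.+ 3 ℕ.* i) l + conj (2 ℕ.+ 3 ℕ.* i) l) ≈ 0#
        conjugates i = trans (Σ<-distrib-+ (n ℕ.+ n) (conj (1 ℕ.+ 3 ℕ.* i)) (conj (2 ℕ.+ 3 ℕ.* i)))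
          (trans (+-cong (conjugate _ (unit3-1+3* i)) (conjugate _ (unit3-2+3* i))) (+-identityˡ 0#))

      -- Only the coefficients at r and n + r survive in the trace relation at s ≡ -r (mod n).
      two-term-relation : ∀ r s t → r ℕ.< n → s ℕ.+ r ≡ n ℕ.* t →
        ⟦ coeff f r ⟧ * trace (n ℕ.* t) + ⟦ coeff f (n ℕ.+ r) ⟧ * trace (n ℕ.* suc t) ≈ 0#
      two-term-relation r s t r<n s+r = begin
        ⟦ coeff f r ⟧ * trace (n ℕ.* t) + ⟦ coeff f (n ℕ.+ r) ⟧ * trace (n ℕ.* suc t)
          ≡⟨ ≡.cong₂ (λ u v → ⟦ coeff f r ⟧ * trace u + ⟦ coeff f (n ℕ.+ r) ⟧ * trace v) s+r s+[n+r] ⟨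
        ⟦ coeff f r ⟧ * trace (s ℕ.+ r) + ⟦ coeff f (n ℕ.+ r) ⟧ * trace (s ℕ.+ (n ℕ.+ r))
          ≈⟨ +-cong (Σ<-single n r r<n (λ i i<n i≢r → trans (*-congˡ (trace-vanishes (s ℕ.+ i) (λ n∣ → i≢r (same i i<n n∣)))) (zeroʳ _)))
                    (Σ<-single n r r<n (λ i i<n i≢r → trans (*-congˡ (trace-vanishes (s ℕ.+ (n ℕ.+ i)) (λ n∣ → i≢r (same i i<n (shift i n∣))))) (zeroʳ _))) ⟨
        Σ< n term + Σ< n (λ i → term (n ℕ.+ i)) ≈⟨ Σ<-split n n term ⟨
        Σ< (n ℕ.+ n) term                       ≈⟨ trace-relation s ⟩
        0#                                      ∎
        where
        term : ℕ → Carrier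
        term l = ⟦ coeff f l ⟧ * trace (s ℕ.+ l)
        exch : ∀ i → s ℕ.+ (n ℕ.+ i) ≡ n ℕ.+ (s ℕ.+ i)
        exch i = ≡.trans (≡.sym (ℕₚ.+-assoc s n i)) (≡.trans (≡.cong (ℕ._+ i) (ℕₚ.+-comm s n)) (ℕₚ.+-assoc n s i))
        s+[n+r] : s ℕ.+ (n ℕ.+ r) ≡ n ℕ.* suc t
        s+[n+r] = ≡.trans (exch r) (≡.trans (≡.cong (n ℕ.+_) s+r) (≡.sym (ℕₚ.*-suc n t)))
        shift : ∀ i → n ∣ s ℕ.+ (n ℕ.+ i) → n ∣ s ℕ.+ i
        shift i n∣ = ∣.∣m+n∣m⇒∣n (≡.subst (n ∣_) (exch i) n∣) ∣.∣-refl
        n∣s+r : n ∣ s ℕ.+ r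
        n∣s+r = ≡.subst (n ∣_) (≡.sym s+r) (∣.m∣m*n t)
        close : ∀ {i j} → i ℕ.≤ j → j ℕ.< n → n ∣ s ℕ.+ i → n ∣ s ℕ.+ j → i ≡ j
        close {i} {j} i≤j j<n n∣i n∣j with j ∸ i in eq
        ... | zero  = ℕₚ.≤-antisym i≤j (ℕₚ.m∸n≡0⇒m≤n eq)
        ... | suc d = contradiction (ℕₚ.≤-<-trans (ℕₚ.≤-trans (ℕₚ.≤-reflexive (≡.sym eq)) (ℕₚ.m∸n≤m j i)) j<n)
                        (ℕₚ.≤⇒≯ (∣.∣⇒≤ (∣.∣m+n∣m⇒∣n (≡.subst (n ∣_) s+j n∣j) n∣i)))
          where
          s+j : s ℕ.+ j ≡ (s ℕ.+ i) ℕ.+ suc d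
          s+j = ≡.trans (≡.cong (s ℕ.+_) (≡.trans (≡.sym (ℕₚ.m+[n∸m]≡n i≤j)) (≡.cong (i ℕ.+_) eq))) (≡.sym (ℕₚ.+-assoc s i (suc d)))
        same : ∀ i → i ℕ.< n → n ∣ s ℕ.+ i → i ≡ r
        same i i<n n∣ with ℕₚ.≤-total i r
        ... | inj₁ i≤r = close i≤r r<n n∣ n∣s+r
        ... | inj₂ r≤i = ≡.sym (close r≤i i<n n∣s+r n∣)

      -- With W = w + w^2, which is -1, two shifts give W x + 2 y = 0 and 2 x + W y = 0, both times
      -- n. Eliminating either unknown leaves three times the other one. The factors 3 and n remain
      -- in the conclusion because inverses are not assumed in `R`.
      coeffs-vanish : ∀ r → r ℕ.< n → ⟦ 3 ℕ.* (coeff f r ℕ.* n) ⟧ ≈ 0# × ⟦ 3 ℕ.* (coeff f (n ℕ.+ r) ℕ.* n) ⟧ ≈ 0#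
      coeffs-vanish r r<n = goal (coeff f r) x-eq , goal (coeff f (n ℕ.+ r)) y-eq
        where
        w = ζ ^ n
        x = ⟦ coeff f r ⟧
        y = ⟦ coeff f (n ℕ.+ r) ⟧
        N = ⟦ n ⟧
        w²+w = w + w * w
        t2 : trace (n ℕ.* 2) ≈ w²+w * N
        t2 = trans (trace-multiple 2) (*-congʳ (trans (+-cong (*-congˡ (*-identityʳ w)) (trans (^-r+3q ω 1 1) (*-identityʳ w))) (+-comm _ _)))
        t3 : trace (n ℕ.* 3) ≈ (1# + 1#) * N
        t3 = trans (trace-multiple 3) (*-congʳ (+-cong (^-3q ω 1) (^-3q ω 2)))
        t4 : trace (n ℕ.* 4) ≈ w²+w * N
        t4 = trans (trace-multiple 4) (*-congʳ (+-cong (trans (^-r+3q ω 1 1) (*-identityʳ w)) (trans (^-r+3q ω 2 2) (*-congˡ (*-identityʳ w)))))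
        complement : ∀ t → r ℕ.≤ n ℕ.* suc t
        complement t = ℕₚ.≤-trans (ℕₚ.<⇒≤ r<n) (ℕₚ.m≤m*n n (suc t))
        -- The shift s = n t - r requires t to be positive when r is. The choice t = 1 would give
        -- the weight W to both coefficients; t = 2 and t = 3 give the independent pairs (W, 2) and
        -- (2, W).
        E₂ : x * (w²+w * N) + y * ((1# + 1#) * N) ≈ 0#
        E₂ = trans (sym (+-cong (*-congˡ t2) (*-congˡ t3))) (two-term-relation r (n ℕ.* 2 ∸ r) 2 r<n (ℕₚ.m∸n+n≡m (complement 1)))
        E₃ : x * ((1# + 1#) * N) + y * (w²+w * N) ≈ 0#
        E₃ = trans (sym (+-cong (*-congˡ t3) (*-congˡ t4))) (two-term-relation r (n ℕ.* 3 ∸ r) 3 r<n (ℕₚ.m∸n+n≡m (complement 2)))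
        combine : ∀ {x y} → x * ((1# + 1#) * N) + y * (w²+w * N) ≈ 0# → x * (w²+w * N) + y * ((1# + 1#) * N) ≈ 0# → (1# + 1# + 1#) * (x * N) ≈ 0#
        combine {x} {y} e₁ e₂ = begin
          (1# + 1# + 1#) * (x * N)  ≈⟨ +-identityʳ _ ⟨
          (1# + 1# + 1#) * (x * N) + 0# ≈⟨ +-congˡ (trans (*-congʳ ω) (zeroˡ _)) ⟨
          -- A multiple of 1 + w + w^2, which is zero, is added so that the expression becomes twice
          -- the first relation plus the second. This replaces the use of W = -1 in the elimination
          -- of y.
          (1# + 1# + 1#) * (x * N) + (1# + w + w * w) * (x * N + (1# + 1#) * (y * N))
            ≈⟨ solve 4 (λ x y w N → con 3 :* (x :* N) :+ (con 1 :+ w :+ w :* w) :* (x :* N :+ con 2 :* (y :* N))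
                  := con 2 :* (x :* (con 2 :* N) :+ y :* ((w :+ w :* w) :* N)) :+ (x :* ((w :+ w :* w) :* N) :+ y :* (con 2 :* N))) refl x y w N ⟩
          (1# + 1#) * (x * ((1# + 1#) * N) + y * (w²+w * N)) + (x * (w²+w * N) + y * ((1# + 1#) * N)) ≈⟨ +-cong (trans (*-congˡ e₁) (zeroʳ _)) e₂ ⟩
          0# + 0# ≈⟨ +-identityˡ 0# ⟩
          0# ∎
        x-eq = combine E₃ E₂
        y-eq = combine (trans (+-comm _ _) E₂) (trans (+-comm _ _) E₃)
        goal : ∀ c → (1# + 1# + 1#) * (⟦ c ⟧ * N) ≈ 0# → ⟦ 3 ℕ.* (c ℕ.* n) ⟧ ≈ 0#
        goal c eq = trans (×1-homo-* 3 (c ℕ.* n)) (trans (*-cong (trans (sym (+-assoc 1# 1# _)) (+-congˡ (+-identityʳ 1#))) (×1-homo-* c n)) eq)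

-- The quotient of a commutative semiring by one element.

module Quotient {c ℓ} (R : CommutativeSemiring c ℓ) (a : CommutativeSemiring.Carrier R) where
  open CommutativeSemiring R
  open NatSolver R using (solve; _:*_; _:+_; _:=_)

  infix 4 _~_
  -- Congruence modulo the ideal generated by `a`, with a multiple of `a` on either side in place of
  -- a difference. Nothing is assumed about `a`.
  record _~_ (x y : Carrier) : Set (c ⊔ ℓ) where
    constructor mk~
    field
      left right : Carrier
      balance    : x + a * left ≈ y + a * right

  ≈⇒~ : ∀ {x y} → x ≈ y → x ~ y
  ≈⇒~ x≈y = mk~ 0# 0# (+-congʳ x≈y)

  ~-isEquivalence : IsEquivalence _~_
  ~-isEquivalence = record
    { refl  = ≈⇒~ refl
    ; sym   = λ (mk~ h k eq) → mk~ k h (sym eq)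
    ; trans = λ { {x} {y} {z} (mk~ h k eq) (mk~ h′ k′ eq′) → mk~ (h + h′) (k + k′) (begin
        x + a * (h + h′)       ≈⟨ solve 4 (λ x a h h′ → x :+ a :* (h :+ h′) := (x :+ a :* h) :+ a :* h′) refl x a h h′ ⟩
        (x + a * h) + a * h′   ≈⟨ +-congʳ eq ⟩
        (y + a * k) + a * h′   ≈⟨ solve 4 (λ y a k h′ → (y :+ a :* k) :+ a :* h′ := (y :+ a :* h′) :+ a :* k) refl y a k h′ ⟩
        (y + a * h′) + a * k   ≈⟨ +-congʳ eq′ ⟩
        (z + a * k′) + a * k   ≈⟨ solve 4 (λ z a k k′ → (z :+ a :* k′) :+ a :* k := z :+ a :* (k :+ k′)) refl z a k k′ ⟩
        z + a * (k + k′)       ∎) }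
    }
    where
    open SetoidReasoning setoid

  quotient : CommutativeSemiring c (c ⊔ ℓ)
  quotient = record
    { Carrier = Carrier ; _≈_ = _~_ ; _+_ = _+_ ; _*_ = _*_ ; 0# = 0# ; 1# = 1#
    ; isCommutativeSemiring = record
      { isSemiring = record
        { isSemiringWithoutAnnihilatingZero = record
          { +-isCommutativeMonoid = record
            { isMonoid = record
              { isSemigroup = record
                { isMagma = record { isEquivalence = ~-isEquivalence ; ∙-cong = +-cong~ }
                ; assoc   = λ x y z → ≈⇒~ (+-assoc x y z) }
              ; identity = (λ x → ≈⇒~ (+-identityˡ x)) , (λ x → ≈⇒~ (+-identityʳ x)) }
            ; comm = λ x y → ≈⇒~ (+-comm x y) }
          ; *-cong     = *-cong~
          ; *-assoc    = λ x y z → ≈⇒~ (*-assoc x y z)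
          ; *-identity = (λ x → ≈⇒~ (*-identityˡ x)) , (λ x → ≈⇒~ (*-identityʳ x))
          ; distrib    = (λ x y z → ≈⇒~ (distribˡ x y z)) , (λ x y z → ≈⇒~ (distribʳ x y z)) }
        ; zero = (λ x → ≈⇒~ (zeroˡ x)) , (λ x → ≈⇒~ (zeroʳ x)) }
      ; *-comm = λ x y → ≈⇒~ (*-comm x y) }
    }
    where
    +-cong~ : ∀ {x y u v} → x ~ y → u ~ v → x + u ~ y + v
    +-cong~ {x} {y} {u} {v} (mk~ h k eq) (mk~ h′ k′ eq′) = mk~ (h + h′) (k + k′)
      (trans (shuffle x u h h′) (trans (+-cong eq eq′) (sym (shuffle y v k k′))))
      where
      shuffle : ∀ x u h h′ → x + u + a * (h + h′) ≈ (x + a * h) + (u + a * h′)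
      shuffle = solve 5 (λ a x u h h′ → x :+ u :+ a :* (h :+ h′) := (x :+ a :* h) :+ (u :+ a :* h′)) refl a
    *-cong~ : ∀ {x y u v} → x ~ y → u ~ v → x * u ~ y * v
    *-cong~ {x} {y} {u} {v} (mk~ h k eq) (mk~ h′ k′ eq′) = mk~ _ _
      (trans (shuffle x u h h′) (trans (*-cong eq eq′) (sym (shuffle y v k k′))))
      where
      shuffle : ∀ x u h h′ → x * u + a * (x * h′ + h * u + a * h * h′) ≈ (x + a * h) * (u + a * h′)
      shuffle = solve 5 (λ a x u h h′ → x :* u :+ a :* (x :* h′ :+ h :* u :+ a :* h :* h′) := (x :+ a :* h) :* (u :+ a :* h′)) refl a

-- The commutative semiring of polynomials over F_p.

coeff-⊕ : ∀ f g i → coeff (f ⊕ g) i ≡ coeff f i ℕ.+ coeff g i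
coeff-⊕ []      g       i       = ≡.refl
coeff-⊕ (a ∷ f) []      i       = ≡.sym (ℕₚ.+-identityʳ _)
coeff-⊕ (a ∷ f) (b ∷ g) zero    = ≡.refl
coeff-⊕ (a ∷ f) (b ∷ g) (suc i) = coeff-⊕ f g i

coeff-scale : ∀ a f i → coeff (scale a f) i ≡ a ℕ.* coeff f i
coeff-scale a []      i       = ≡.sym (ℕₚ.*-zeroʳ a)
coeff-scale a (b ∷ f) zero    = ≡.refl
coeff-scale a (b ∷ f) (suc i) = coeff-scale a f i

module PolyRing (p : ℕ) (pp : Prime p) where
  open Poly p pp using (_≈_)

  private instance
    p≢0 = prime⇒nonZero pp

  infix 4 _≡ₘ_ _≃_

  -- Record wrappers, so that f and g can be inferred from f ≃ g.
  record _≡ₘ_ (a b : ℕ) : Set where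
    constructor mkₘ
    field %≡ : a % p ≡ b % p
  open _≡ₘ_ public

  ≡ₘ-refl : ∀ {a} → a ≡ₘ a
  ≡ₘ-refl = mkₘ ≡.refl

  ≡ₘ-sym : ∀ {a b} → a ≡ₘ b → b ≡ₘ a
  ≡ₘ-sym (mkₘ eq) = mkₘ (≡.sym eq)

  ≡ₘ-trans : ∀ {a b c} → a ≡ₘ b → b ≡ₘ c → a ≡ₘ c
  ≡ₘ-trans (mkₘ eq) (mkₘ eq′) = mkₘ (≡.trans eq eq′)

  ≡⇒≡ₘ : ∀ {a b} → a ≡ b → a ≡ₘ b
  ≡⇒≡ₘ ≡.refl = ≡ₘ-refl

  +-congₘ : ∀ {a b c d} → a ≡ₘ b → c ≡ₘ d → a ℕ.+ c ≡ₘ b ℕ.+ d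
  +-congₘ {a} {b} {c} {d} (mkₘ ab) (mkₘ cd) = mkₘ (≡.trans (%-distribˡ-+ a c p)
    (≡.trans (≡.cong₂ (λ x y → (x ℕ.+ y) % p) ab cd) (≡.sym (%-distribˡ-+ b d p))))

  *-congₘ : ∀ {a b c d} → a ≡ₘ b → c ≡ₘ d → a ℕ.* c ≡ₘ b ℕ.* d
  *-congₘ {a} {b} {c} {d} (mkₘ ab) (mkₘ cd) = mkₘ (≡.trans (%-distribˡ-* a c p)
    (≡.trans (≡.cong₂ (λ x y → (x ℕ.* y) % p) ab cd) (≡.sym (%-distribˡ-* b d p))))

  ∣⇒≡ₘ0 : ∀ {a} → p ∣ a → a ≡ₘ 0
  ∣⇒≡ₘ0 {a} p∣a = mkₘ (≡.trans (n∣m⇒m%n≡0 a p p∣a) (≡.sym (n∣m⇒m%n≡0 0 p (p ∣.∣0))))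

  ≡ₘ0⇒∣ : ∀ {a} → a ≡ₘ 0 → p ∣ a
  ≡ₘ0⇒∣ {a} (mkₘ eq) = m%n≡0⇒n∣m a p (≡.trans eq (n∣m⇒m%n≡0 0 p (p ∣.∣0)))

  record _≃_ (f g : RawPoly) : Set where
    constructor mk≃
    field coeffs : ∀ i → coeff f i ≡ₘ coeff g i
  open _≃_ public

  ≃⇒≈ : ∀ {f g} → f ≃ g → f ≈ g
  ≃⇒≈ (mk≃ eq) i = %≡ (eq i)

  ≈⇒≃ : ∀ {f g} → f ≈ g → f ≃ g
  ≈⇒≃ eq = mk≃ (λ i → mkₘ (eq i))

  exact : ∀ {f g} → (∀ i → coeff f i ≡ coeff g i) → f ≃ g
  exact eq = mk≃ (λ i → ≡⇒≡ₘ (eq i))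

  ≃-isEquivalence : IsEquivalence _≃_
  ≃-isEquivalence = record
    { refl  = exact (λ _ → ≡.refl)
    ; sym   = λ (mk≃ eq) → mk≃ (λ i → ≡ₘ-sym (eq i))
    ; trans = λ (mk≃ eq) (mk≃ eq′) → mk≃ (λ i → ≡ₘ-trans (eq i) (eq′ i))
    }

  ⊕-cong : ∀ {f f′ g g′} → f ≃ f′ → g ≃ g′ → f ⊕ g ≃ f′ ⊕ g′
  ⊕-cong {f} {f′} {g} {g′} (mk≃ eq) (mk≃ eq′) = mk≃ (λ i →
    ≡ₘ-trans (≡⇒≡ₘ (coeff-⊕ f g i)) (≡ₘ-trans (+-congₘ (eq i) (eq′ i)) (≡⇒≡ₘ (≡.sym (coeff-⊕ f′ g′ i)))))

  ⊕-commutativeMonoid : CommutativeMonoid _ _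
  ⊕-commutativeMonoid = record
    { Carrier = RawPoly ; _≈_ = _≃_ ; _∙_ = _⊕_ ; ε = []
    ; isCommutativeMonoid = record
      { isMonoid = record
        { isSemigroup = record
          { isMagma = record { isEquivalence = ≃-isEquivalence ; ∙-cong = ⊕-cong }
          ; assoc   = λ f g h → exact (assoc f g h) }
        ; identity = (λ f → exact (λ _ → ≡.refl)) , (λ f → exact (λ i → ≡.trans (coeff-⊕ f [] i) (ℕₚ.+-identityʳ _))) }
      ; comm = λ f g → exact (λ i → ≡.trans (coeff-⊕ f g i) (≡.trans (ℕₚ.+-comm (coeff f i) _) (≡.sym (coeff-⊕ g f i)))) }
    }
    where
    assoc : ∀ f g h i → coeff ((f ⊕ g) ⊕ h) i ≡ coeff (f ⊕ (g ⊕ h)) i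
    assoc f g h i rewrite coeff-⊕ (f ⊕ g) h i | coeff-⊕ f g i | coeff-⊕ f (g ⊕ h) i | coeff-⊕ g h i = ℕₚ.+-assoc (coeff f i) _ _

  open CommutativeMonoid ⊕-commutativeMonoid public using (setoid)
    renaming (refl to ≃-refl; sym to ≃-sym; trans to ≃-trans; assoc to ⊕-assoc; comm to ⊕-comm; identityˡ to ⊕-identityˡ; identityʳ to ⊕-identityʳ; ∙-congˡ to ⊕-congˡ; ∙-congʳ to ⊕-congʳ)
  open import Algebra.Properties.CommutativeSemigroup (CommutativeMonoid.commutativeSemigroup ⊕-commutativeMonoid)
    using (interchange; x∙yz≈y∙xz)

  scale-cong : ∀ {a b f g} → a ≡ₘ b → f ≃ g → scale a f ≃ scale b g
  scale-cong {a} {b} {f} {g} a≡b (mk≃ eq) = mk≃ (λ i →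
    ≡ₘ-trans (≡⇒≡ₘ (coeff-scale a f i)) (≡ₘ-trans (*-congₘ a≡b (eq i)) (≡⇒≡ₘ (≡.sym (coeff-scale b g i)))))

  ∷-cong : ∀ {a b f g} → a ≡ₘ b → f ≃ g → a ∷ f ≃ b ∷ g
  ∷-cong a≡b (mk≃ eq) = mk≃ (λ { zero → a≡b ; (suc i) → eq i })

  0∷[]≃[] : 0 ∷ [] ≃ []
  0∷[]≃[] = exact (λ { zero → ≡.refl ; (suc i) → ≡.refl })

  scale-zero : ∀ f → scale 0 f ≃ []
  scale-zero f = exact (coeff-scale 0 f)

  scale-one : ∀ f → scale 1 f ≃ f
  scale-one f = exact (λ i → ≡.trans (coeff-scale 1 f i) (ℕₚ.*-identityˡ _))

  scale-scale : ∀ a b f → scale a (scale b f) ≃ scale (a ℕ.* b) f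
  scale-scale a b f = exact eq
    where
    eq : ∀ i → coeff (scale a (scale b f)) i ≡ coeff (scale (a ℕ.* b) f) i
    eq i rewrite coeff-scale a (scale b f) i | coeff-scale b f i | coeff-scale (a ℕ.* b) f i = ≡.sym (ℕₚ.*-assoc a b _)

  scale-⊕ : ∀ a f g → scale a (f ⊕ g) ≃ scale a f ⊕ scale a g
  scale-⊕ a f g = exact eq
    where
    eq : ∀ i → coeff (scale a (f ⊕ g)) i ≡ coeff (scale a f ⊕ scale a g) i
    eq i rewrite coeff-scale a (f ⊕ g) i | coeff-⊕ f g i | coeff-⊕ (scale a f) (scale a g) i | coeff-scale a f i | coeff-scale a g i = ℕₚ.*-distribˡ-+ a (coeff f i) _

  ⊗-congˡ : ∀ f {g h} → g ≃ h → f ⊗ g ≃ f ⊗ h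
  ⊗-congˡ []      eq = ≃-refl
  ⊗-congˡ (a ∷ f) eq = ⊕-cong (scale-cong ≡ₘ-refl eq) (∷-cong ≡ₘ-refl (⊗-congˡ f eq))

  ⊗-zeroʳ : ∀ f → f ⊗ [] ≃ []
  ⊗-zeroʳ []      = ≃-refl
  ⊗-zeroʳ (a ∷ f) = ≃-trans (∷-cong ≡ₘ-refl (⊗-zeroʳ f)) 0∷[]≃[]

  -- The mirror image of the defining recursion of `⊗`, which is on the left factor. Commutativity
  -- follows from it by induction, and commutativity then yields congruence and distributivity on
  -- the other side.
  ⊗-∷ : ∀ f b g → f ⊗ (b ∷ g) ≃ scale b f ⊕ (0 ∷ (f ⊗ g))
  ⊗-∷ []      b g = ≃-sym 0∷[]≃[]
  ⊗-∷ (a ∷ f) b g = ∷-cong (≡⇒≡ₘ (≡.cong (ℕ._+ 0) (ℕₚ.*-comm a b))) (begin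
    scale a g ⊕ (f ⊗ (b ∷ g))                  ≈⟨ ⊕-congˡ (⊗-∷ f b g) ⟩
    scale a g ⊕ (scale b f ⊕ (0 ∷ (f ⊗ g)))    ≈⟨ x∙yz≈y∙xz (scale a g) (scale b f) (0 ∷ (f ⊗ g)) ⟩
    scale b f ⊕ (scale a g ⊕ (0 ∷ (f ⊗ g)))    ∎)
    where
    open SetoidReasoning setoid

  ⊗-comm : ∀ f g → f ⊗ g ≃ g ⊗ f
  ⊗-comm []      g = ≃-sym (⊗-zeroʳ g)
  ⊗-comm (a ∷ f) g = ≃-trans (⊕-congˡ (∷-cong ≡ₘ-refl (⊗-comm f g))) (≃-sym (⊗-∷ g a f))

  ⊗-cong : ∀ {f f′ g g′} → f ≃ f′ → g ≃ g′ → f ⊗ g ≃ f′ ⊗ g′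
  ⊗-cong {f} {f′} {g} {g′} f≃f′ g≃g′ = ≃-trans (⊗-congˡ f g≃g′)
    (≃-trans (⊗-comm f g′) (≃-trans (⊗-congˡ g′ f≃f′) (⊗-comm g′ f′)))

  ⊗-distribˡ-⊕ : ∀ f g h → f ⊗ (g ⊕ h) ≃ (f ⊗ g) ⊕ (f ⊗ h)
  ⊗-distribˡ-⊕ []      g h = ≃-refl
  ⊗-distribˡ-⊕ (a ∷ f) g h = ≃-trans (⊕-cong (scale-⊕ a g h) (∷-cong ≡ₘ-refl (⊗-distribˡ-⊕ f g h)))
    (interchange (scale a g) (scale a h) (0 ∷ (f ⊗ g)) (0 ∷ (f ⊗ h)))

  ⊗-distribʳ-⊕ : ∀ h f g → (f ⊕ g) ⊗ h ≃ (f ⊗ h) ⊕ (g ⊗ h)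
  ⊗-distribʳ-⊕ h f g = ≃-trans (⊗-comm (f ⊕ g) h) (≃-trans (⊗-distribˡ-⊕ h f g) (⊕-cong (⊗-comm h f) (⊗-comm h g)))

  scale-⊗ : ∀ a f g → scale a f ⊗ g ≃ scale a (f ⊗ g)
  scale-⊗ a []      g = ≃-refl
  scale-⊗ a (b ∷ f) g = ≃-trans (⊕-cong (≃-sym (scale-scale a b g))
      (∷-cong (≡⇒≡ₘ (≡.sym (ℕₚ.*-zeroʳ a))) (scale-⊗ a f g)))
    (≃-sym (scale-⊕ a (scale b g) (0 ∷ (f ⊗ g))))

  0∷-⊗ : ∀ f g → (0 ∷ f) ⊗ g ≃ 0 ∷ (f ⊗ g)
  0∷-⊗ f g = ⊕-congʳ (scale-zero g)

  ⊗-assoc : ∀ f g h → (f ⊗ g) ⊗ h ≃ f ⊗ (g ⊗ h)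
  ⊗-assoc []      g h = ≃-refl
  ⊗-assoc (a ∷ f) g h = begin
    (scale a g ⊕ (0 ∷ (f ⊗ g))) ⊗ h             ≈⟨ ⊗-distribʳ-⊕ h (scale a g) (0 ∷ (f ⊗ g)) ⟩
    (scale a g ⊗ h) ⊕ ((0 ∷ (f ⊗ g)) ⊗ h)       ≈⟨ ⊕-cong (scale-⊗ a g h) (0∷-⊗ (f ⊗ g) h) ⟩
    scale a (g ⊗ h) ⊕ (0 ∷ ((f ⊗ g) ⊗ h))       ≈⟨ ⊕-congˡ (∷-cong ≡ₘ-refl (⊗-assoc f g h)) ⟩
    scale a (g ⊗ h) ⊕ (0 ∷ (f ⊗ (g ⊗ h)))       ∎
    where
    open SetoidReasoning setoid

  scale≃⊗ : ∀ a f → [ a ] ⊗ f ≃ scale a f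
  scale≃⊗ a f = ≃-trans (⊕-congˡ 0∷[]≃[]) (⊕-identityʳ (scale a f))

  ⊗-identityˡ : ∀ f → [ 1 ] ⊗ f ≃ f
  ⊗-identityˡ f = ≃-trans (scale≃⊗ 1 f) (scale-one f)

  polySemiring : CommutativeSemiring _ _
  polySemiring = record
    { Carrier = RawPoly ; _≈_ = _≃_ ; _+_ = _⊕_ ; _*_ = _⊗_ ; 0# = [] ; 1# = [ 1 ]
    ; isCommutativeSemiring = record
      { isSemiring = record
        { isSemiringWithoutAnnihilatingZero = record
          { +-isCommutativeMonoid = CommutativeMonoid.isCommutativeMonoid ⊕-commutativeMonoid
          ; *-cong     = ⊗-cong
          ; *-assoc    = ⊗-assoc
          ; *-identity = ⊗-identityˡ , (λ f → ≃-trans (⊗-comm f [ 1 ]) (⊗-identityˡ f))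
          ; distrib    = ⊗-distribˡ-⊕ , ⊗-distribʳ-⊕ }
        ; zero = (λ _ → ≃-refl) , ⊗-zeroʳ }
      ; *-comm = ⊗-comm }
    }

-- Degrees, division with remainder, and irreducible implies prime.

module PolyDivision (p : ℕ) (pp : Prime p) where
  open Poly p pp using (IsUnit; Irreducible; _∣ₚ_)
  open PolyRing p pp
  open NatSolver polySemiring using (solve; _:*_; _:+_; _:=_; con)

  private instance
    p≢0 = prime⇒nonZero pp

  _≡ₘ0? : ∀ a → Dec (a ≡ₘ 0)
  a ≡ₘ0? with a % p ℕ.≟ 0 % p
  ... | yes eq = yes (mkₘ eq)
  ... | no neq = no (neq ∘ %≡)

  ν : ℕ
  ν = p ∸ 1

  1+ν≡p : 1 ℕ.+ ν ≡ p
  1+ν≡p = ℕₚ.m+[n∸m]≡n (ℕ.>-nonZero⁻¹ p)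

  1+ν≡0 : 1 ℕ.+ ν ≡ₘ 0
  1+ν≡0 = ∣⇒≡ₘ0 (∣.∣-reflexive (≡.sym 1+ν≡p))

  1≢ₘ0 : ¬ 1 ≡ₘ 0
  1≢ₘ0 eq = ℕₚ.<-irrefl (≡.sym (∣.∣1⇒≡1 (≡ₘ0⇒∣ eq))) (ℕ.nonTrivial⇒n>1 p {{prime⇒nonTrivial pp}})

  *≡0⇒ : ∀ {a b} → a ℕ.* b ≡ₘ 0 → a ≡ₘ 0 ⊎ b ≡ₘ 0
  *≡0⇒ {a} {b} eq with euclidsLemma a b pp (≡ₘ0⇒∣ eq)
  ... | inj₁ p∣a = inj₁ (∣⇒≡ₘ0 p∣a)
  ... | inj₂ p∣b = inj₂ (∣⇒≡ₘ0 p∣b)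

  -- The square of -1 is 1: adding 1 + a to a^2 changes nothing, and the sum is (1 + a) a + 1.
  1+≡0⇒²≡1 : ∀ {a} → 1 ℕ.+ a ≡ₘ 0 → a ℕ.* a ≡ₘ 1
  1+≡0⇒²≡1 {a} eq = ≡ₘ-trans (≡ₘ-trans (≡⇒≡ₘ (≡.sym (ℕₚ.+-identityʳ _))) (+-congₘ ≡ₘ-refl (≡ₘ-sym eq)))
    (≡ₘ-trans (≡⇒≡ₘ (S.solve 1 (λ a → a S.:* a S.:+ (S.con 1 S.:+ a) S.:= (S.con 1 S.:+ a) S.:* a S.:+ S.con 1) ≡.refl a))
      (+-congₘ (*-congₘ eq ≡ₘ-refl) ≡ₘ-refl))
    where
    module S = +-*-Solver

  ν²≡1 : ν ℕ.* ν ≡ₘ 1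
  ν²≡1 = 1+≡0⇒²≡1 1+ν≡0

  inverse : ∀ a → ¬ a ≡ₘ 0 → ∃ λ b → a ℕ.* b ≡ₘ 1
  inverse a a≢0 = convert (coprime-Bézout (prime⇒coprime pp {{ℕ.≢-nonZero r≢0}} (m%n<n a p)))
    where
    a≡r : a % p ≡ₘ a
    a≡r = mkₘ (m%n%n≡m%n a p)
    r≢0 : a % p ≢ 0
    r≢0 eq = a≢0 (≡ₘ-trans (≡ₘ-sym a≡r) (≡⇒≡ₘ eq))
    *p≡0 : ∀ x → x ℕ.* p ≡ₘ 0
    *p≡0 x = ∣⇒≡ₘ0 (∣.n∣m*n x)
    convert : Bézout.Identity 1 p (a % p) → ∃ λ b → a ℕ.* b ≡ₘ 1
    -- This form of Bézout's identity says that a y is -1 modulo p. Hence a times y (a y) is the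
    -- square of -1.
    convert (Bézout.+- x y eq) = b , ≡ₘ-trans (≡⇒≡ₘ (≡.sym (ℕₚ.*-assoc a y _))) (1+≡0⇒²≡1
        (≡ₘ-trans (+-congₘ ≡ₘ-refl (≡ₘ-trans (≡⇒≡ₘ (ℕₚ.*-comm a y)) (*-congₘ (≡ₘ-refl {y}) (≡ₘ-sym a≡r)))) (≡ₘ-trans (≡⇒≡ₘ eq) (*p≡0 x))))
      where b = y ℕ.* (a ℕ.* y)
    convert (Bézout.-+ x y eq) = y , ≡ₘ-trans (≡⇒≡ₘ (ℕₚ.*-comm a y)) (≡ₘ-trans (*-congₘ (≡ₘ-refl {y}) (≡ₘ-sym a≡r))
        (≡ₘ-trans (≡⇒≡ₘ (≡.sym eq)) (+-congₘ (≡ₘ-refl {1}) (*p≡0 x))))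

  []-cong : ∀ {a b} → a ≡ₘ b → [ a ] ≃ [ b ]
  []-cong eq = ∷-cong eq ≃-refl

  [0]≃ : ∀ {a} → a ≡ₘ 0 → [ a ] ≃ []
  [0]≃ eq = ≃-trans ([]-cong eq) 0∷[]≃[]

  [a]⊗[b] : ∀ a b → [ a ] ⊗ [ b ] ≃ [ a ℕ.* b ]
  [a]⊗[b] a b = scale≃⊗ a [ b ]

  ⊕-inverse : ∀ f → f ⊕ ([ ν ] ⊗ f) ≃ []
  ⊕-inverse f = ≃-trans (solve 2 (λ f n → f :+ n :* f := (con 1 :+ n) :* f) ≃-refl f [ ν ])
    (⊗-cong ([0]≃ 1+ν≡0) ≃-refl)

  -- A relation rather than a function of the list, because a raw list may end in multiples of p.
  -- The zero polynomial has no degree.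
  record Deg (f : RawPoly) (d : ℕ) : Set where
    constructor mkDeg
    field
      lead≢0 : ¬ coeff f d ≡ₘ 0
      above  : ∀ i → d ℕ.< i → coeff f i ≡ₘ 0
  open Deg public

  Deg-resp : ∀ {f g d} → f ≃ g → Deg f d → Deg g d
  Deg-resp (mk≃ eq) (mkDeg l a) = mkDeg (l ∘ ≡ₘ-trans (eq _)) (λ i d<i → ≡ₘ-trans (≡ₘ-sym (eq i)) (a i d<i))

  Deg-unique : ∀ {f d e} → Deg f d → Deg f e → d ≡ e
  Deg-unique {d = d} {e} (mkDeg l a) (mkDeg l′ a′) with ℕₚ.<-cmp d e
  ... | tri< d<e _ _ = contradiction (a e d<e) l′
  ... | tri≈ _ d≡e _ = d≡e
  ... | tri> _ _ e<d = contradiction (a′ d e<d) l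

  Deg⇒≄[] : ∀ {f d} → Deg f d → ¬ f ≃ []
  Deg⇒≄[] (mkDeg l a) (mk≃ eq) = l (eq _)

  zeroOrDeg : ∀ f → f ≃ [] ⊎ ∃ (Deg f)
  zeroOrDeg []      = inj₁ ≃-refl
  zeroOrDeg (a ∷ f) with zeroOrDeg f
  ... | inj₂ (d , mkDeg l ab) = inj₂ (suc d , mkDeg l (λ { (suc i) (s<s d<i) → ab i d<i }))
  ... | inj₁ f≃[] with a ≡ₘ0?
  ...   | yes a≡0 = inj₁ (≃-trans (∷-cong a≡0 f≃[]) 0∷[]≃[])
  ...   | no a≢0 = inj₂ (0 , mkDeg a≢0 (λ { (suc i) _ → coeffs f≃[] i }))

  -- Only upper bounds for the degrees are assumed, which suits the induction on `f` and also gives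
  -- the leading coefficient of a product.
  ⊗-top : ∀ f g m n → (∀ i → m ℕ.< i → coeff f i ≡ₘ 0) → (∀ i → n ℕ.< i → coeff g i ≡ₘ 0) →
          coeff (f ⊗ g) (m ℕ.+ n) ≡ₘ coeff f m ℕ.* coeff g n × (∀ i → m ℕ.+ n ℕ.< i → coeff (f ⊗ g) i ≡ₘ 0)
  ⊗-top []      g m n _  _  = ≡ₘ-refl , λ _ _ → ≡ₘ-refl
  ⊗-top (a ∷ f) g zero n f> g> = value n , λ i n<i → ≡ₘ-trans (value i) (≡ₘ-trans (*-congₘ (≡ₘ-refl {a}) (g> i n<i)) (≡⇒≡ₘ (ℕₚ.*-zeroʳ a)))
    where
    product : (a ∷ f) ⊗ g ≃ scale a g
    product = ≃-trans (⊗-cong (∷-cong (≡ₘ-refl {a}) (mk≃ {f} {[]} (λ i → f> (suc i) z<s))) (≃-refl {g})) (scale≃⊗ a g)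
    value : ∀ i → coeff ((a ∷ f) ⊗ g) i ≡ₘ a ℕ.* coeff g i
    value i = ≡ₘ-trans (coeffs product i) (≡⇒≡ₘ (coeff-scale a g i))
  ⊗-top (a ∷ f) g (suc m) n f> g> with ⊗-top f g m n (λ i m<i → f> (suc i) (s<s m<i)) g>
  ... | top , rest = ≡ₘ-trans (value (m ℕ.+ n) (ℕₚ.m≤n+m n m)) top ,
        λ { (suc i) (s<s m+n<i) → ≡ₘ-trans (value i (ℕₚ.≤-trans (ℕₚ.m≤n+m n m) (ℕₚ.<⇒≤ m+n<i))) (rest i m+n<i) }
    where
    value : ∀ i → n ℕ.≤ i → coeff ((a ∷ f) ⊗ g) (suc i) ≡ₘ coeff (f ⊗ g) i
    value i n≤i = ≡ₘ-trans (≡⇒≡ₘ (≡.trans (coeff-⊕ (scale a g) (0 ∷ (f ⊗ g)) (suc i)) (≡.cong (ℕ._+ coeff (f ⊗ g) i) (coeff-scale a g (suc i)))))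
      (+-congₘ (≡ₘ-trans (*-congₘ (≡ₘ-refl {a}) (g> (suc i) (s≤s n≤i))) (≡⇒≡ₘ (ℕₚ.*-zeroʳ a))) ≡ₘ-refl)

  Deg-⊗ : ∀ {f g m n} → Deg f m → Deg g n → Deg (f ⊗ g) (m ℕ.+ n)
  Deg-⊗ {f} {g} {m} {n} (mkDeg l a) (mkDeg l′ a′) with ⊗-top f g m n a a′
  ... | top , rest = mkDeg (λ eq → no-zero (*≡0⇒ (≡ₘ-trans (≡ₘ-sym top) eq))) rest
    where
    no-zero : ¬ (coeff f m ≡ₘ 0 ⊎ coeff g n ≡ₘ 0)
    no-zero (inj₁ eq) = l eq
    no-zero (inj₂ eq) = l′ eq

  Deg-factors : ∀ {f a b d} → Deg f d → f ≃ a ⊗ b → ∃₂ λ m n → Deg a m × Deg b n × m ℕ.+ n ≡ d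
  Deg-factors {f} {a} {b} D eq with zeroOrDeg a | zeroOrDeg b
  ... | inj₁ a≃[] | _ = contradiction (≃-trans eq (⊗-cong a≃[] ≃-refl)) (Deg⇒≄[] D)
  ... | inj₂ _ | inj₁ b≃[] = contradiction (≃-trans eq (≃-trans (⊗-cong (≃-refl {a}) b≃[]) (⊗-zeroʳ a))) (Deg⇒≄[] D)
  ... | inj₂ (m , Da) | inj₂ (n , Db) = m , n , Da , Db , Deg-unique (Deg-resp (≃-sym eq) (Deg-⊗ Da Db)) D

  Deg-[] : ∀ {c} → ¬ c ≡ₘ 0 → Deg [ c ] 0
  Deg-[] c≢0 = mkDeg c≢0 (λ { (suc i) _ → ≡ₘ-refl })

  Deg0⇒constant : ∀ {f} → Deg f 0 → f ≃ [ coeff f 0 ]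
  Deg0⇒constant (mkDeg _ a) = mk≃ (λ { zero → ≡ₘ-refl ; (suc i) → a (suc i) z<s })

  Deg0⇒unit : ∀ {f} → Deg f 0 → IsUnit f
  Deg0⇒unit {f} D with inverse (coeff f 0) (lead≢0 D)
  ... | b , eq = [ b ] , ≃⇒≈ (≃-trans (⊗-cong (Deg0⇒constant D) (≃-refl {[ b ]})) (≃-trans ([a]⊗[b] (coeff f 0) b) ([]-cong eq)))

  unit⇒Deg0 : ∀ {f} → IsUnit f → Deg f 0
  unit⇒Deg0 {f} (v , eq) with Deg-factors (Deg-[] 1≢ₘ0) (≃-sym (≈⇒≃ {f ⊗ v} {[ 1 ]} eq))
  ... | zero , _ , Df , _ , _ = Df

  -- Degrees add, so a nonzero constant has only constant factors. In other words, F_p embeds in the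
  -- quotient by a nonconstant polynomial.
  Deg>0⇒¬∣constant : ∀ {f g c d} → Deg f (suc d) → [ c ] ≃ f ⊗ g → c ≡ₘ 0
  Deg>0⇒¬∣constant {c = c} D eq with c ≡ₘ0?
  ... | yes c≡0 = c≡0
  ... | no c≢0 with Deg-factors (Deg-[] c≢0) eq
  ...   | m , n , Df , _ , m+n≡0 with () ← ≡.trans (Deg-unique D Df) (ℕₚ.m+n≡0⇒m≡0 m m+n≡0)

  irreducible-criterion : ∀ {f d} → Deg f (suc d) →
    (∀ a b m n → f ≃ a ⊗ b → Deg a (suc m) → Deg b (suc n) → suc m ℕ.+ suc n ≢ suc d) → Irreducible f
  irreducible-criterion {f} D noFactor =
    (λ f≈[] → Deg⇒≄[] D (≈⇒≃ {f} {[]} f≈[])) ,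
    (λ u → contradiction (Deg-unique D (unit⇒Deg0 u)) (λ ())) ,
    λ a b f≈ab → split a b (≈⇒≃ {f} {a ⊗ b} f≈ab) (Deg-factors {a = a} {b} D (≈⇒≃ {f} {a ⊗ b} f≈ab))
    where
    split : ∀ a b → f ≃ a ⊗ b → (∃₂ λ m n → Deg a m × Deg b n × m ℕ.+ n ≡ _) → IsUnit a ⊎ IsUnit b
    split a b eq (zero  , n     , Da , Db , _) = inj₁ (Deg0⇒unit Da)
    split a b eq (suc m , zero  , Da , Db , _) = inj₂ (Deg0⇒unit Db)
    split a b eq (suc m , suc n , Da , Db , e) = contradiction e (noFactor a b m n eq Da Db)

  Irreducible-resp : ∀ {f g} → f ≃ g → Irreducible f → Irreducible g
  Irreducible-resp {f} {g} f≃g (nz , nu , irr) =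
    (λ g≈[] → nz (≃⇒≈ (≃-trans f≃g (≈⇒≃ {g} {[]} g≈[])))) ,
    (λ (v , eq) → nu (v , ≃⇒≈ (≃-trans (⊗-cong f≃g (≃-refl {v})) (≈⇒≃ {g ⊗ v} {[ 1 ]} eq)))) ,
    λ a b g≈ab → irr a b (≃⇒≈ (≃-trans f≃g (≈⇒≃ {g} {a ⊗ b} g≈ab)))

  infix 4 _∣ᵖ_
  record _∣ᵖ_ (f g : RawPoly) : Set where
    constructor _,_
    field
      cofactor : RawPoly
      factors  : g ≃ f ⊗ cofactor

  ∣ᵖ-resp : ∀ {f g h} → g ≃ h → f ∣ᵖ g → f ∣ᵖ h
  ∣ᵖ-resp g≃h (q , eq) = q , ≃-trans (≃-sym g≃h) eq

  ∣ᵖ-trans : ∀ {f g h} → f ∣ᵖ g → g ∣ᵖ h → f ∣ᵖ h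
  ∣ᵖ-trans {f} (q , eq) (r , eq′) = q ⊗ r , ≃-trans eq′ (≃-trans (⊗-cong eq (≃-refl {r})) (⊗-assoc f q r))

  ∣ᵖ-⊕ : ∀ {f g h} → f ∣ᵖ g → f ∣ᵖ h → f ∣ᵖ g ⊕ h
  ∣ᵖ-⊕ {f} (q , eq) (r , eq′) = q ⊕ r , ≃-trans (⊕-cong eq eq′) (≃-sym (⊗-distribˡ-⊕ f q r))

  ∣ᵖ-⊗ : ∀ {f g} → f ∣ᵖ g → ∀ h → f ∣ᵖ g ⊗ h
  ∣ᵖ-⊗ f∣g h = ∣ᵖ-trans f∣g (h , ≃-refl)

  -- The cofactor is k - h, with ν as -1. This converts congruence to zero in the quotient into
  -- divisibility.
  balance⇒∣ᵖ : ∀ {a c h k} → c ⊕ (a ⊗ h) ≃ a ⊗ k → a ∣ᵖ c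
  balance⇒∣ᵖ {a} {c} {h} {k} eq = k ⊕ ([ ν ] ⊗ h) , (begin
    c                                        ≈⟨ ⊕-identityʳ c ⟨
    c ⊕ []                                   ≈⟨ ⊕-congˡ (⊕-inverse (a ⊗ h)) ⟨
    c ⊕ ((a ⊗ h) ⊕ ([ ν ] ⊗ (a ⊗ h)))        ≈⟨ solve 4 (λ c a h n → c :+ (a :* h :+ n :* (a :* h)) := (c :+ a :* h) :+ a :* (n :* h)) ≃-refl c a h [ ν ] ⟩
    (c ⊕ (a ⊗ h)) ⊕ (a ⊗ ([ ν ] ⊗ h))        ≈⟨ ⊕-congʳ eq ⟩
    (a ⊗ k) ⊕ (a ⊗ ([ ν ] ⊗ h))              ≈⟨ ⊗-distribˡ-⊕ a k ([ ν ] ⊗ h) ⟨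
    a ⊗ (k ⊕ ([ ν ] ⊗ h))                    ∎)
    where
    open SetoidReasoning setoid

  -- Recursion on the coefficient list of the dividend: from f = g q + r one gets a + x f = g (x q)
  -- + (a + x r). The new remainder has degree at most d, and subtracting t g, where t is its
  -- coefficient at d divided by the leading coefficient of g, brings it below d.
  divide : ∀ {g d} → Deg g d → ∀ f → ∃₂ λ q r → f ≃ (g ⊗ q) ⊕ r × (∀ i → d ℕ.≤ i → coeff r i ≡ₘ 0)
  divide {g} D [] = [] , [] , ≃-sym (≃-trans (⊕-identityʳ _) (⊗-zeroʳ g)) , λ _ _ → ≡ₘ-refl
  divide {g} {d} D (a ∷ f) with divide D f | inverse (coeff g d) (lead≢0 D)
  ... | q , r , eq , r< | b , gb≡1 = (0 ∷ q) ⊕ [ t ] , (a ∷ r) ⊕ ([ ν ] ⊗ ([ t ] ⊗ g)) , split , bound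
    where
    open SetoidReasoning setoid
    c = coeff (a ∷ r) d
    t = c ℕ.* b
    split : a ∷ f ≃ (g ⊗ ((0 ∷ q) ⊕ [ t ])) ⊕ ((a ∷ r) ⊕ ([ ν ] ⊗ ([ t ] ⊗ g)))
    split = begin
      a ∷ f                                ≈⟨ ∷-cong ≡ₘ-refl eq ⟩
      (0 ∷ (g ⊗ q)) ⊕ (a ∷ r)              ≈⟨ ⊕-congʳ (≃-sym (≃-trans (⊗-∷ g 0 q) (⊕-congʳ (scale-zero g)))) ⟩
      (g ⊗ (0 ∷ q)) ⊕ (a ∷ r)              ≈⟨ ⊕-identityʳ _ ⟨
      ((g ⊗ (0 ∷ q)) ⊕ (a ∷ r)) ⊕ []       ≈⟨ ⊕-congˡ (⊕-inverse ([ t ] ⊗ g)) ⟨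
      ((g ⊗ (0 ∷ q)) ⊕ (a ∷ r)) ⊕ (([ t ] ⊗ g) ⊕ ([ ν ] ⊗ ([ t ] ⊗ g)))
        ≈⟨ solve 5 (λ g q r t n → (g :* q :+ r) :+ (t :* g :+ n :* (t :* g)) := g :* (q :+ t) :+ (r :+ n :* (t :* g))) ≃-refl g (0 ∷ q) (a ∷ r) [ t ] [ ν ] ⟩
      (g ⊗ ((0 ∷ q) ⊕ [ t ])) ⊕ ((a ∷ r) ⊕ ([ ν ] ⊗ ([ t ] ⊗ g))) ∎
    value : ∀ i → coeff ((a ∷ r) ⊕ ([ ν ] ⊗ ([ t ] ⊗ g))) i ≡ₘ coeff (a ∷ r) i ℕ.+ ν ℕ.* (t ℕ.* coeff g i)
    value i = ≡ₘ-trans (≡⇒≡ₘ (coeff-⊕ (a ∷ r) ([ ν ] ⊗ ([ t ] ⊗ g)) i)) (+-congₘ (≡ₘ-refl {coeff (a ∷ r) i})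
      (≡ₘ-trans (coeffs (≃-trans (scale≃⊗ ν ([ t ] ⊗ g)) (scale-cong (≡ₘ-refl {ν}) (scale≃⊗ t g))) i)
        (≡⇒≡ₘ (≡.trans (coeff-scale ν (scale t g) i) (≡.cong (ν ℕ.*_) (coeff-scale t g i))))))
    ar> : ∀ i → d ℕ.< i → coeff (a ∷ r) i ≡ₘ 0
    ar> (suc i) (s<s d≤i) = r< i d≤i
    bound : ∀ i → d ℕ.≤ i → coeff ((a ∷ r) ⊕ ([ ν ] ⊗ ([ t ] ⊗ g))) i ≡ₘ 0
    bound i d≤i with ℕₚ.m≤n⇒m<n∨m≡n d≤i
    ... | inj₁ d<i = ≡ₘ-trans (value i) (+-congₘ (ar> i d<i) (≡ₘ-trans (*-congₘ (≡ₘ-refl {ν}) (*-congₘ (≡ₘ-refl {t}) (above D i d<i)))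
                       (≡⇒≡ₘ (≡.trans (≡.cong (ν ℕ.*_) (ℕₚ.*-zeroʳ t)) (ℕₚ.*-zeroʳ ν)))))
    ... | inj₂ ≡.refl = ≡ₘ-trans (value d) (≡ₘ-trans (≡⇒≡ₘ (S.solve 4 (λ c n b g → c S.:+ n S.:* (c S.:* b S.:* g) S.:= c S.:+ n S.:* c S.:* (g S.:* b)) ≡.refl c ν b (coeff g d)))
                      (≡ₘ-trans (+-congₘ (≡ₘ-refl {c}) (*-congₘ (≡ₘ-refl {ν ℕ.* c}) gb≡1))
                      (≡ₘ-trans (≡⇒≡ₘ (S.solve 2 (λ c n → c S.:+ n S.:* c S.:* S.con 1 S.:= (S.con 1 S.:+ n) S.:* c) ≡.refl c ν)) (*-congₘ 1+ν≡0 (≡ₘ-refl {c})))))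
      where
      module S = +-*-Solver

  record BézoutGCD (f g : RawPoly) : Set where
    field
      d u v    : RawPoly
      d∣f      : d ∣ᵖ f
      d∣g      : d ∣ᵖ g
      identity : d ≃ (u ⊗ f) ⊕ (v ⊗ g)

  -- Euclid's algorithm, with `n` bounding the length of the second argument up to zeros modulo p
  -- and serving as termination measure.
  bézout : ∀ n f g → (∀ i → n ℕ.≤ i → coeff g i ≡ₘ 0) → BézoutGCD f g
  bézout n f g g< with zeroOrDeg g
  bézout n f g g< | inj₁ g≃[] = record
    { d = f ; u = [ 1 ] ; v = []
    ; d∣f = [ 1 ] , ≃-sym (≃-trans (⊗-comm f [ 1 ]) (⊗-identityˡ f))
    ; d∣g = [] , ≃-trans g≃[] (≃-sym (⊗-zeroʳ f))
    ; identity = ≃-sym (≃-trans (⊕-identityʳ _) (⊗-identityˡ f)) }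
  bézout zero f g g< | inj₂ (e , D) = contradiction (g< e z≤n) (lead≢0 D)
  bézout (suc n) f g g< | inj₂ (e , D) with divide D f
  ... | q , r , eq , r< with bézout n g r (λ i n≤i → r< i (ℕₚ.≤-trans e≤n n≤i))
    where
    e≤n : e ℕ.≤ n
    e≤n with ℕₚ.<-≤-connex n e
    ... | inj₁ n<e = contradiction (g< e n<e) (lead≢0 D)
    ... | inj₂ e≤n = e≤n
  ... | G = record
    -- Substituting r = f - g q into d = u g + v r gives v f + (u - v q) g.
    { d = d ; u = v ; v = u ⊕ ([ ν ] ⊗ (v ⊗ q))
    ; d∣f = ∣ᵖ-resp (≃-sym eq) (∣ᵖ-⊕ (∣ᵖ-⊗ d∣f q) d∣g)
    ; d∣g = d∣f
    ; identity = begin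
        d                                                ≈⟨ identity ⟩
        (u ⊗ g) ⊕ (v ⊗ r)                                ≈⟨ ⊕-identityʳ _ ⟨
        ((u ⊗ g) ⊕ (v ⊗ r)) ⊕ []                         ≈⟨ ⊕-congˡ (⊕-inverse (v ⊗ (g ⊗ q))) ⟨
        ((u ⊗ g) ⊕ (v ⊗ r)) ⊕ ((v ⊗ (g ⊗ q)) ⊕ ([ ν ] ⊗ (v ⊗ (g ⊗ q))))
          ≈⟨ solve 6 (λ u v g q r n → (u :* g :+ v :* r) :+ (v :* (g :* q) :+ n :* (v :* (g :* q))) := v :* (g :* q :+ r) :+ (u :+ n :* (v :* q)) :* g) ≃-refl u v g q r [ ν ] ⟩
        (v ⊗ ((g ⊗ q) ⊕ r)) ⊕ ((u ⊕ ([ ν ] ⊗ (v ⊗ q))) ⊗ g) ≈⟨ ⊕-congʳ (⊗-congˡ v (≃-sym eq)) ⟩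
        (v ⊗ f) ⊕ ((u ⊕ ([ ν ] ⊗ (v ⊗ q))) ⊗ g)          ∎ }
    where
    open BézoutGCD G
    open SetoidReasoning setoid

  coeff-≥length : ∀ f i → length f ℕ.≤ i → coeff f i ≡ 0
  coeff-≥length []      i       _         = ≡.refl
  coeff-≥length (a ∷ f) (suc i) (s≤s f≤i) = coeff-≥length f i f≤i

  -- The gcd d of q and f is a factor of q. If d is a unit, the Bézout identity times g exhibits g
  -- as a combination of q and f g. If its cofactor is a unit, q divides d and therefore f.
  irreducible⇒prime : ∀ {q} → Irreducible q → ∀ f g → q ∣ᵖ f ⊗ g → q ∣ᵖ f ⊎ q ∣ᵖ g
  irreducible⇒prime {q} (_ , _ , irr) f g q∣fg = conclude (bézout (length f) q f (λ i l → ≡⇒≡ₘ (coeff-≥length f i l)))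
    where
    open SetoidReasoning setoid
    conclude : BézoutGCD q f → q ∣ᵖ f ⊎ q ∣ᵖ g
    conclude record { d = d ; u = u ; v = v ; d∣f = d∣f ; d∣g = d∣g ; identity = identity } with d∣f
    ... | e , q≃de with irr d e (≃⇒≈ q≃de)
    ...   | inj₁ (w , dw≈1) = inj₂ (∣ᵖ-resp (begin
              (((u ⊗ w) ⊗ g) ⊗ q) ⊕ ((v ⊗ w) ⊗ (f ⊗ g)) ≈⟨ solve 6 (λ u v w g q f → ((u :* w) :* g) :* q :+ (v :* w) :* (f :* g) := ((u :* q :+ v :* f) :* w) :* g) ≃-refl u v w g q f ⟩
              (((u ⊗ q) ⊕ (v ⊗ f)) ⊗ w) ⊗ g             ≈⟨ ⊗-cong (⊗-cong identity (≃-refl {w})) ≃-refl ⟨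
              (d ⊗ w) ⊗ g                               ≈⟨ ⊗-cong (≈⇒≃ {d ⊗ w} {[ 1 ]} dw≈1) ≃-refl ⟩
              [ 1 ] ⊗ g                                 ≈⟨ ⊗-identityˡ g ⟩
              g                                         ∎)
            (∣ᵖ-⊕ ((u ⊗ w) ⊗ g , ⊗-comm _ q) (∣ᵖ-resp (⊗-comm (f ⊗ g) (v ⊗ w)) (∣ᵖ-⊗ q∣fg (v ⊗ w)))))
    ...   | inj₂ (w , ew≈1) = inj₁ (∣ᵖ-trans (w , (begin
              d                ≈⟨ solve 1 (λ d → d := d :* con 1) ≃-refl d ⟩
              d ⊗ [ 1 ]        ≈⟨ ⊗-congˡ d (≈⇒≃ {e ⊗ w} {[ 1 ]} ew≈1) ⟨
              d ⊗ (e ⊗ w)      ≈⟨ ⊗-assoc d e w ⟨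
              (d ⊗ e) ⊗ w      ≈⟨ ⊗-cong q≃de (≃-refl {w}) ⟨
              q ⊗ w            ∎)) d∣g)

-- Irreducibility of the polynomials `F 1 (3 ^ k)`.

∤3 : ∀ p → p % 9 ≡ 2 ⊎ p % 9 ≡ 5 → ¬ p ∣ 3
∤3 0 (inj₁ ())
∤3 0 (inj₂ ())
∤3 1 (inj₁ ())
∤3 1 (inj₂ ())
∤3 2 _ = from-no (2 ∣? 3)
∤3 3 (inj₁ ())
∤3 3 (inj₂ ())
∤3 (suc (suc (suc (suc _)))) _ p∣3 with ∣.∣⇒≤ p∣3
... | s≤s (s≤s (s≤s ()))

module Cyclotomic (p : ℕ) (pp : Prime p) (p%9 : p % 9 ≡ 2 ⊎ p % 9 ≡ 5) where
  open Poly p pp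
  open PolyRing p pp
  open PolyDivision p pp
  open NatSolver polySemiring using (solve; _:*_; _:+_; _:=_; con)
  open import Algebra.Properties.CommutativeSemiring.Exp polySemiring
  module ℕS = +-*-Solver

  -- Opaque, so that products with X do not unfold during type checking.
  opaque
    X : RawPoly
    X = 0 ∷ [ 1 ]

    X≡ : X ≡ 0 ∷ [ 1 ]
    X≡ = ≡.refl

  X⊗ : ∀ f → X ⊗ f ≃ 0 ∷ f
  X⊗ f rewrite X≡ = ≃-trans (0∷-⊗ [ 1 ] f) (∷-cong ≡ₘ-refl (⊗-identityˡ f))

  mono : ℕ → RawPoly
  mono zero    = [ 1 ]
  mono (suc n) = 0 ∷ mono n

  X^≃mono : ∀ n → X ^ n ≃ mono n
  X^≃mono zero    = ≃-refl
  X^≃mono (suc n) = ≃-trans (X⊗ (X ^ n)) (∷-cong ≡ₘ-refl (X^≃mono n))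

  coeff-mono-≡ : ∀ n → coeff (mono n) n ≡ 1
  coeff-mono-≡ zero    = ≡.refl
  coeff-mono-≡ (suc n) = coeff-mono-≡ n

  coeff-mono-≢ : ∀ n i → i ≢ n → coeff (mono n) i ≡ 0
  coeff-mono-≢ zero    zero    i≢n = contradiction ≡.refl i≢n
  coeff-mono-≢ zero    (suc i) i≢n = ≡.refl
  coeff-mono-≢ (suc n) zero    i≢n = ≡.refl
  coeff-mono-≢ (suc n) (suc i) i≢n = coeff-mono-≢ n i (i≢n ∘ ≡.cong suc)

  record MonicDeg (f : RawPoly) (d : ℕ) : Set where
    constructor mkMonic
    field
      lead≡1 : coeff f d ≡ₘ 1
      above  : ∀ i → d ℕ.< i → coeff f i ≡ₘ 0

  monic⇒Deg : ∀ {f d} → MonicDeg f d → Deg f d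
  monic⇒Deg (mkMonic l a) = mkDeg (λ eq → 1≢ₘ0 (≡ₘ-trans (≡ₘ-sym l) eq)) a

  monic-resp : ∀ {f g d} → f ≃ g → MonicDeg f d → MonicDeg g d
  monic-resp f≃g (mkMonic l a) = mkMonic (≡ₘ-trans (≡ₘ-sym (coeffs f≃g _)) l) (λ i d<i → ≡ₘ-trans (≡ₘ-sym (coeffs f≃g i)) (a i d<i))

  X^-monic : ∀ n → MonicDeg (X ^ n) n
  X^-monic n = monic-resp (≃-sym (X^≃mono n)) (mkMonic (≡⇒≡ₘ (coeff-mono-≡ n)) (λ i n<i → ≡⇒≡ₘ (coeff-mono-≢ n i (≡.≢-sym (ℕₚ.<⇒≢ n<i)))))

  lower⊕monic : ∀ {f g d} → (∀ i → d ℕ.≤ i → coeff f i ≡ₘ 0) → MonicDeg g d → MonicDeg (f ⊕ g) d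
  lower⊕monic {f} {g} {d} f< (mkMonic l a) = mkMonic
    (≡ₘ-trans (≡⇒≡ₘ (coeff-⊕ f g d)) (+-congₘ (f< d ℕₚ.≤-refl) l))
    (λ i d<i → ≡ₘ-trans (≡⇒≡ₘ (coeff-⊕ f g i)) (+-congₘ (f< i (ℕₚ.<⇒≤ d<i)) (a i d<i)))

  X⊕-monic : ∀ e → MonicDeg (X ⊕ [ e ]) 1
  X⊕-monic e rewrite X≡ = mkMonic ≡ₘ-refl (λ { (suc (suc i)) _ → ≡ₘ-refl ; (suc zero) (s≤s ()) })

  linear-irreducible : ∀ {f} → Deg f 1 → Irreducible f
  linear-irreducible D = irreducible-criterion D λ _ _ m n _ _ _ eq →
    contradiction (≡.trans (≡.sym (ℕₚ.+-suc m n)) (ℕₚ.suc-injective eq)) (λ ())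

  -- The cofactor must be a unit, hence a constant, and comparison of leading coefficients makes it
  -- 1. This is how an irreducible divisor is recognised as a member of the set.
  irreducible-∣⇒≃ : ∀ {q f d e} → Irreducible q → Irreducible f → MonicDeg q d → MonicDeg f e → q ∣ᵖ f → q ≃ f
  irreducible-∣⇒≃ {q} {f} {d} {e} (_ , q-nonunit , _) (_ , _ , irr) Mq Mf (h , f≃qh) with irr q h (≃⇒≈ f≃qh)
  ... | inj₁ q-unit = contradiction q-unit q-nonunit
  ... | inj₂ h-unit = begin
      q              ≈⟨ solve 1 (λ q → q := q :* con 1) ≃-refl q ⟩
      q ⊗ [ 1 ]      ≈⟨ ⊗-congˡ q (≃-trans (Deg0⇒constant Dh) ([]-cong h₀≡1)) ⟨
      q ⊗ h          ≈⟨ f≃qh ⟨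
      f              ∎
    where
    open SetoidReasoning setoid
    Dh = unit⇒Deg0 h-unit
    e≡d : e ≡ d ℕ.+ 0
    e≡d = Deg-unique (monic⇒Deg Mf) (Deg-resp (≃-sym f≃qh) (Deg-⊗ (monic⇒Deg Mq) Dh))
    h₀≡1 : coeff h 0 ≡ₘ 1
    h₀≡1 = ≡ₘ-trans (≡⇒≡ₘ (≡.sym (ℕₚ.*-identityˡ _))) (≡ₘ-trans (*-congₘ (≡ₘ-sym (MonicDeg.lead≡1 Mq)) (≡ₘ-refl {coeff h 0}))
      (≡ₘ-trans (≡ₘ-sym (proj₁ (⊗-top q h d 0 (MonicDeg.above Mq) (Deg.above Dh))))
      (≡ₘ-trans (≡ₘ-sym (coeffs f≃qh (d ℕ.+ 0))) (≡.subst (λ j → coeff f j ≡ₘ 1) e≡d (MonicDeg.lead≡1 Mf)))))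

  F : ℕ → ℕ → RawPoly
  F e m = ([ 1 ] ⊕ ([ e ] ⊗ (X ^ m))) ⊕ ((X ^ m) ⊗ (X ^ m))

  F-cong : ∀ {e e′} m → e ≡ₘ e′ → F e m ≃ F e′ m
  F-cong m eq = ⊕-congʳ {(X ^ m) ⊗ (X ^ m)} (⊕-congˡ {[ 1 ]} (⊗-cong ([]-cong eq) (≃-refl {X ^ m})))

  F-monic : ∀ e m → 0 ℕ.< m → MonicDeg (F e m) (m ℕ.+ m)
  F-monic e m 0<m = lower⊕monic lower (monic-resp (^-homo-* X m m) (X^-monic (m ℕ.+ m)))
    where
    m<m+m : m ℕ.< m ℕ.+ m
    m<m+m = ℕₚ.m<m+n m 0<m
    lower : ∀ i → m ℕ.+ m ℕ.≤ i → coeff ([ 1 ] ⊕ ([ e ] ⊗ (X ^ m))) i ≡ₘ 0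
    lower i 2m≤i = ≡ₘ-trans (≡⇒≡ₘ (coeff-⊕ [ 1 ] ([ e ] ⊗ (X ^ m)) i)) (+-congₘ (one i (ℕₚ.<-trans 0<m m<i))
      (≡ₘ-trans (coeffs (scale≃⊗ e (X ^ m)) i) (≡ₘ-trans (≡⇒≡ₘ (coeff-scale e (X ^ m) i))
        (≡ₘ-trans (*-congₘ (≡ₘ-refl {e}) (MonicDeg.above (X^-monic m) i m<i)) (≡⇒≡ₘ (ℕₚ.*-zeroʳ e))))))
      where
      m<i : m ℕ.< i
      m<i = ℕₚ.<-≤-trans m<m+m 2m≤i
      one : ∀ i → 0 ℕ.< i → coeff [ 1 ] i ≡ₘ 0
      one (suc i) _ = ≡ₘ-refl

  0<3^ : ∀ k → 0 ℕ.< 3 ℕ.^ k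
  0<3^ k = ℕₚ.m^n>0 3 k

  3≢ₘ0 : ¬ 3 ≡ₘ 0
  3≢ₘ0 eq = ∤3 p p%9 (≡ₘ0⇒∣ eq)

  3^≢ₘ0 : ∀ k → ¬ 3 ℕ.^ k ≡ₘ 0
  3^≢ₘ0 zero    eq = 1≢ₘ0 eq
  3^≢ₘ0 (suc k) eq with *≡0⇒ {3} {3 ℕ.^ k} eq
  ... | inj₁ 3≡0 = 3≢ₘ0 3≡0
  ... | inj₂ 3^k≡0 = 3^≢ₘ0 k 3^k≡0

  cancel-3^ : ∀ k c → 3 ℕ.* (c ℕ.* 3 ℕ.^ k) ≡ₘ 0 → c ≡ₘ 0
  cancel-3^ k c eq with *≡0⇒ {3} {c ℕ.* 3 ℕ.^ k} eq
  ... | inj₁ 3≡0 = contradiction 3≡0 3≢ₘ0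
  ... | inj₂ c*3^k≡0 with *≡0⇒ {c} {3 ℕ.^ k} c*3^k≡0
  ...   | inj₁ c≡0   = c≡0
  ...   | inj₂ 3^k≡0 = contradiction 3^k≡0 (3^≢ₘ0 k)

  module _ (a : RawPoly) where
    open Quotient polySemiring a
    private
      module A = CommutativeSemiring quotient
      module ×A = SemiringMult A.semiring

    ×1~[] : ∀ c → c ×A.× [ 1 ] ~ [ c ]
    ×1~[] zero    = ≈⇒~ (≃-sym 0∷[]≃[])
    ×1~[] (suc c) = A.+-congˡ {[ 1 ]} (×1~[] c)

    p×1~0 : p ×A.× [ 1 ] ~ []
    p×1~0 = A.trans (×1~[] p) (≈⇒~ ([0]≃ (∣⇒≡ₘ0 ∣.∣-refl)))

    open Frobenius quotient p pp p×1~0 using (eval; ⟦_⟧)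

    -- The class of x is the tautological root: evaluating `a` there gives `a` itself, which is zero
    -- in the quotient.
    eval-X : ∀ f → eval f X ~ f
    eval-X []      = A.refl
    eval-X (c ∷ f) = A.trans (A.+-cong (×1~[] c) (A.*-congˡ {X} (eval-X f)))
      (≈⇒~ (≃-trans (⊕-congˡ {[ c ]} (X⊗ f)) (∷-cong (≡⇒≡ₘ (ℕₚ.+-identityʳ c)) ≃-refl)))

    -- The trace identities also hold in the zero ring, so nontriviality of the quotient must enter
    -- somewhere. It enters here, through the positive degree of `a`.
    constant~0 : ∀ {d} → Deg a (suc d) → ∀ c → ⟦ c ⟧ ~ [] → c ≡ₘ 0
    constant~0 D c eq = Deg>0⇒¬∣constant D (_∣ᵖ_.factors (divisible (A.trans (A.sym (×1~[] c)) eq)))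
      where
      divisible : [ c ] ~ [] → a ∣ᵖ [ c ]
      divisible (mk~ _ _ balance) = balance⇒∣ᵖ balance

    no-proper-factor : ∀ k b d → F 1 (3 ℕ.^ k) ≃ a ⊗ b → Deg a (suc d) → ¬ suc d ℕ.< 3 ℕ.^ k ℕ.+ 3 ℕ.^ k
    no-proper-factor k b d F≃ab D d<2n = lead≢0 D (lead≡0 (ℕₚ.<-≤-connex (suc d) n))
      where
      n = 3 ℕ.^ k
      open Trace quotient p pp p%9 p×1~0 using (PrimitiveCubeRoot; module Root)
      open import Algebra.Properties.Semiring.Exp A.semiring using () renaming (_^_ to _^A_)
      ^A≃ : ∀ m → X ^A m ~ X ^ m
      ^A≃ zero    = A.refl
      ^A≃ (suc m) = A.*-congˡ {X} (^A≃ m)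
      ω : PrimitiveCubeRoot (X ^A n)
      ω = A.trans (A.+-cong (A.+-congˡ {[ 1 ]} (^A≃ n)) (A.*-cong (^A≃ n) (^A≃ n)))
        (A.trans (≈⇒~ (⊕-congʳ {(X ^ n) ⊗ (X ^ n)} (⊕-congˡ {[ 1 ]} (≃-sym (⊗-identityˡ (X ^ n))))))
                 (mk~ [] b (≃-trans (⊕-congˡ {F 1 n} (⊗-zeroʳ a)) (≃-trans (⊕-identityʳ (F 1 n)) F≃ab))))
      a~0 : eval a X ~ []
      a~0 = A.trans (eval-X a) (mk~ [] [ 1 ] (solve 1 (λ a → a :+ a :* con 0 := con 0 :+ a :* con 1) ≃-refl a))
      constant≡0 : ∀ c → ⟦ 3 ℕ.* (c ℕ.* n) ⟧ ~ [] → c ≡ₘ 0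
      constant≡0 c eq = cancel-3^ k c (constant~0 D (3 ℕ.* (c ℕ.* n)) eq)
      vanish = Root.coeffs-vanish k X ω a a~0 (λ i 2n≤i → ≡ₘ0⇒∣ (Deg.above D i (ℕₚ.<-≤-trans d<2n 2n≤i)))
      -- The leading index of `a` is below 2n, so it has the form r or n + r with r < n. One of the
      -- two vanishing statements therefore kills the leading coefficient.
      lead≡0 : suc d ℕ.< n ⊎ n ℕ.≤ suc d → coeff a (suc d) ≡ₘ 0
      lead≡0 (inj₁ d<n) = constant≡0 _ (proj₁ (vanish (suc d) d<n))
      lead≡0 (inj₂ n≤d) = ≡.subst (λ j → coeff a j ≡ₘ 0) (ℕₚ.m+[n∸m]≡n n≤d)
        (constant≡0 _ (proj₂ (vanish (suc d ∸ n) (ℕₚ.+-cancelˡ-< n _ _ (≡.subst (ℕ._< n ℕ.+ n) (≡.sym (ℕₚ.m+[n∸m]≡n n≤d)) d<2n)))))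

  F1-irreducible : ∀ k → Irreducible (F 1 (3 ℕ.^ k))
  F1-irreducible k = go (n ℕ.+ n) ≡.refl
    where
    n = 3 ℕ.^ k
    D : Deg (F 1 n) (n ℕ.+ n)
    D = monic⇒Deg (F-monic 1 n (0<3^ k))
    go : ∀ d → d ≡ n ℕ.+ n → Irreducible (F 1 n)
    go zero    0≡2n = contradiction (ℕₚ.m+n≡0⇒m≡0 n (≡.sym 0≡2n)) (≡.≢-sym (ℕₚ.<⇒≢ (0<3^ k)))
    go (suc d) eq = irreducible-criterion (≡.subst (Deg (F 1 n)) (≡.sym eq) D)
      λ a b i j F≃ab Da Db i+j → no-proper-factor a k b i F≃ab Da
        (≡.subst (suc i ℕ.<_) (≡.trans i+j eq) (ℕₚ.m<m+n (suc i) z<s))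

  -- The substitution x ↦ c x, and the factorisation of x^(3m) + e.

  -- f ↦ f(c x)
  twist : ℕ → RawPoly → RawPoly
  twist c []      = []
  twist c (a ∷ f) = a ∷ scale c (twist c f)

  coeff-twist : ∀ c f i → coeff (twist c f) i ≡ c ℕ.^ i ℕ.* coeff f i
  coeff-twist c []      i       = ≡.sym (ℕₚ.*-zeroʳ (c ℕ.^ i))
  coeff-twist c (a ∷ f) zero    = ≡.sym (ℕₚ.*-identityˡ a)
  coeff-twist c (a ∷ f) (suc i) = ≡.trans (coeff-scale c (twist c f) i)
    (≡.trans (≡.cong (c ℕ.*_) (coeff-twist c f i)) (≡.sym (ℕₚ.*-assoc c (c ℕ.^ i) _)))

  twist-cong : ∀ c {f g} → f ≃ g → twist c f ≃ twist c g
  twist-cong c {f} {g} (mk≃ eq) = mk≃ (λ i → ≡ₘ-trans (≡⇒≡ₘ (coeff-twist c f i))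
    (≡ₘ-trans (*-congₘ (≡ₘ-refl {c ℕ.^ i}) (eq i)) (≡⇒≡ₘ (≡.sym (coeff-twist c g i)))))

  twist-⊕ : ∀ c f g → twist c (f ⊕ g) ≃ twist c f ⊕ twist c g
  twist-⊕ c f g = exact eq
    where
    eq : ∀ i → coeff (twist c (f ⊕ g)) i ≡ coeff (twist c f ⊕ twist c g) i
    eq i rewrite coeff-twist c (f ⊕ g) i | coeff-⊕ f g i | coeff-⊕ (twist c f) (twist c g) i | coeff-twist c f i | coeff-twist c g i
      = ℕₚ.*-distribˡ-+ (c ℕ.^ i) (coeff f i) _

  twist-scale : ∀ c a f → twist c (scale a f) ≃ scale a (twist c f)
  twist-scale c a f = exact eq
    where
    eq : ∀ i → coeff (twist c (scale a f)) i ≡ coeff (scale a (twist c f)) i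
    eq i rewrite coeff-twist c (scale a f) i | coeff-scale a f i | coeff-scale a (twist c f) i | coeff-twist c f i
      = ℕS.solve 3 (λ x a f → x ℕS.:* (a ℕS.:* f) ℕS.:= a ℕS.:* (x ℕS.:* f)) ≡.refl (c ℕ.^ i) a (coeff f i)

  twist-⊗ : ∀ c f g → twist c (f ⊗ g) ≃ twist c f ⊗ twist c g
  twist-⊗ c []      g = ≃-refl
  twist-⊗ c (a ∷ f) g = begin
    twist c (scale a g ⊕ (0 ∷ (f ⊗ g)))                        ≈⟨ twist-⊕ c (scale a g) (0 ∷ (f ⊗ g)) ⟩
    twist c (scale a g) ⊕ (0 ∷ scale c (twist c (f ⊗ g)))      ≈⟨ ⊕-cong (twist-scale c a g) (∷-cong ≡ₘ-refl (scale-cong (≡ₘ-refl {c}) (twist-⊗ c f g))) ⟩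
    scale a (twist c g) ⊕ (0 ∷ scale c (twist c f ⊗ twist c g)) ≈⟨ ⊕-congˡ (∷-cong ≡ₘ-refl (scale-⊗ c (twist c f) (twist c g))) ⟨
    scale a (twist c g) ⊕ (0 ∷ (scale c (twist c f) ⊗ twist c g)) ∎
    where
    open SetoidReasoning setoid

  twist-X^ : ∀ c m → twist c (X ^ m) ≃ [ c ℕ.^ m ] ⊗ (X ^ m)
  twist-X^ c m = ≃-trans (twist-cong c (X^≃mono m)) (≃-trans (exact eq) (≃-trans (≃-sym (scale≃⊗ (c ℕ.^ m) (mono m))) (⊗-congˡ [ c ℕ.^ m ] (≃-sym (X^≃mono m)))))
    where
    eq : ∀ i → coeff (twist c (mono m)) i ≡ coeff (scale (c ℕ.^ m) (mono m)) i
    eq i rewrite coeff-twist c (mono m) i | coeff-scale (c ℕ.^ m) (mono m) i with i ℕ.≟ m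
    ... | yes ≡.refl = ≡.refl
    ... | no i≢m rewrite coeff-mono-≢ m i i≢m = ≡.trans (ℕₚ.*-zeroʳ (c ℕ.^ i)) (≡.sym (ℕₚ.*-zeroʳ (c ℕ.^ m)))

  module _ {e : ℕ} (e²≡1 : e ℕ.* e ≡ₘ 1) where

    ^²≡1 : ∀ i → e ℕ.^ i ℕ.* e ℕ.^ i ≡ₘ 1
    ^²≡1 zero    = ≡ₘ-refl
    ^²≡1 (suc i) = ≡ₘ-trans (≡⇒≡ₘ (ℕS.solve 2 (λ e x → e ℕS.:* x ℕS.:* (e ℕS.:* x) ℕS.:= e ℕS.:* e ℕS.:* (x ℕS.:* x)) ≡.refl e (e ℕ.^ i)))
      (*-congₘ e²≡1 (^²≡1 i))

    -- All exponents 3^k are odd: a cube is a square, here 1, times the original power. Hence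
    -- replacing x by e x multiplies the middle term of `F 1 (3 ^ k)` by e and leaves the outer
    -- terms alone.
    ^3^k≡ : ∀ k → e ℕ.^ (3 ℕ.^ k) ≡ₘ e
    ^3^k≡ zero    = ≡⇒≡ₘ (ℕₚ.*-identityʳ e)
    ^3^k≡ (suc k) = ≡ₘ-trans (≡⇒≡ₘ (≡.trans (≡.cong (e ℕ.^_) (ℕₚ.*-comm 3 (3 ℕ.^ k))) (≡.sym (ℕₚ.^-*-assoc e (3 ℕ.^ k) 3))))
      (≡ₘ-trans (≡⇒≡ₘ (ℕS.solve 1 (λ x → x ℕS.:* (x ℕS.:* (x ℕS.:* ℕS.con 1)) ℕS.:= x ℕS.:* x ℕS.:* x) ≡.refl x))
      (≡ₘ-trans (*-congₘ (^²≡1 (3 ℕ.^ k)) (^3^k≡ k)) (≡⇒≡ₘ (ℕₚ.*-identityˡ e))))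
      where x = e ℕ.^ (3 ℕ.^ k)

    twist-involutive : ∀ f → twist e (twist e f) ≃ f
    twist-involutive f = mk≃ (λ i → ≡ₘ-trans (≡⇒≡ₘ (≡.trans (coeff-twist e (twist e f) i) (≡.trans (≡.cong (e ℕ.^ i ℕ.*_) (coeff-twist e f i)) (≡.sym (ℕₚ.*-assoc (e ℕ.^ i) (e ℕ.^ i) _)))))
      (≡ₘ-trans (*-congₘ (^²≡1 i) (≡ₘ-refl {coeff f i})) (≡⇒≡ₘ (ℕₚ.*-identityˡ _))))

    twist-unit : ∀ {f g} → twist e f ≃ g → IsUnit f → IsUnit g
    twist-unit {f} {g} tf≃g (v , fv≈1) = twist e v , ≃⇒≈ (begin
      g ⊗ twist e v            ≈⟨ ⊗-cong tf≃g (≃-refl {twist e v}) ⟨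
      twist e f ⊗ twist e v    ≈⟨ twist-⊗ e f v ⟨
      twist e (f ⊗ v)          ≈⟨ twist-cong e (≈⇒≃ {f ⊗ v} {[ 1 ]} fv≈1) ⟩
      [ 1 ]                    ∎)
      where
      open SetoidReasoning setoid

    -- For e^2 = 1 the substitution is a multiplicative involution, so a factorisation of the image
    -- can be carried back to `f` and its unit factor forward again.
    twist-irreducible : ∀ {f} → Irreducible f → Irreducible (twist e f)
    twist-irreducible {f} (nz , nu , irr) =
      (λ tf≈0 → nz (≃⇒≈ (≃-trans (≃-sym (twist-involutive f)) (twist-cong e (≈⇒≃ {twist e f} {[]} tf≈0))))) ,
      (λ u → nu (twist-unit (twist-involutive f) u)) ,
      λ a b tf≈ab → untwist a b (irr (twist e a) (twist e b) (≃⇒≈ (≃-trans (≃-sym (twist-involutive f))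
        (≃-trans (twist-cong e (≈⇒≃ {twist e f} {a ⊗ b} tf≈ab)) (twist-⊗ e a b)))))
      where
      untwist : ∀ a b → IsUnit (twist e a) ⊎ IsUnit (twist e b) → IsUnit a ⊎ IsUnit b
      untwist a b (inj₁ u) = inj₁ (twist-unit (twist-involutive a) u)
      untwist a b (inj₂ u) = inj₂ (twist-unit (twist-involutive b) u)

    twist-F : ∀ m → twist e (F 1 m) ≃ F (e ℕ.^ m) m
    twist-F m = begin
      twist e (([ 1 ] ⊕ ([ 1 ] ⊗ y)) ⊕ (y ⊗ y))      ≈⟨ twist-⊕ e ([ 1 ] ⊕ ([ 1 ] ⊗ y)) (y ⊗ y) ⟩
      twist e ([ 1 ] ⊕ ([ 1 ] ⊗ y)) ⊕ twist e (y ⊗ y) ≈⟨ ⊕-cong (twist-⊕ e [ 1 ] ([ 1 ] ⊗ y)) (twist-⊗ e y y) ⟩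
      ([ 1 ] ⊕ twist e ([ 1 ] ⊗ y)) ⊕ (ty ⊗ ty)      ≈⟨ ⊕-congʳ {ty ⊗ ty} (⊕-congˡ {[ 1 ]} (twist-cong e {[ 1 ] ⊗ y} {y} (⊗-identityˡ y))) ⟩
      ([ 1 ] ⊕ ty) ⊕ (ty ⊗ ty)                       ≈⟨ ⊕-cong (⊕-congˡ {[ 1 ]} (twist-X^ e m)) (⊗-cong (twist-X^ e m) (twist-X^ e m)) ⟩
      ([ 1 ] ⊕ (c ⊗ y)) ⊕ ((c ⊗ y) ⊗ (c ⊗ y))        ≈⟨ solve 2 (λ c y → (con 1 :+ c :* y) :+ (c :* y) :* (c :* y) := (con 1 :+ c :* y) :+ (c :* c) :* (y :* y)) ≃-refl c y ⟩
      ([ 1 ] ⊕ (c ⊗ y)) ⊕ ((c ⊗ c) ⊗ (y ⊗ y))        ≈⟨ ⊕-congˡ {[ 1 ] ⊕ (c ⊗ y)} (≃-trans (⊗-cong (≃-trans ([a]⊗[b] (e ℕ.^ m) (e ℕ.^ m)) ([]-cong (^²≡1 m))) (≃-refl {y ⊗ y})) (⊗-identityˡ (y ⊗ y))) ⟩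
      ([ 1 ] ⊕ (c ⊗ y)) ⊕ (y ⊗ y)                    ∎
      where
      open SetoidReasoning setoid
      y = X ^ m
      ty = twist e y
      c = [ e ℕ.^ m ]

    F-irreducible : ∀ k → Irreducible (F e (3 ℕ.^ k))
    F-irreducible k = Irreducible-resp (≃-trans (twist-F (3 ℕ.^ k)) (F-cong (3 ℕ.^ k) (^3^k≡ k))) (twist-irreducible {F 1 (3 ℕ.^ k)} (F1-irreducible k))

    ν*e²≡1 : (ν ℕ.* e) ℕ.* (ν ℕ.* e) ≡ₘ 1
    ν*e²≡1 = ≡ₘ-trans (≡⇒≡ₘ (ℕS.solve 2 (λ n e → n ℕS.:* e ℕS.:* (n ℕS.:* e) ℕS.:= n ℕS.:* n ℕS.:* (e ℕS.:* e)) ≡.refl ν e)) (*-congₘ ν²≡1 e²≡1)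

    X^3m⊕e : ∀ m → (X ^ (3 ℕ.* m)) ⊕ [ e ] ≃ ((X ^ m) ⊕ [ e ]) ⊗ F (ν ℕ.* e) m
    X^3m⊕e m = begin
      (X ^ (3 ℕ.* m)) ⊕ c                       ≡⟨ ≡.cong (λ j → (X ^ j) ⊕ c) (ℕₚ.*-comm 3 m) ⟩
      (X ^ (m ℕ.* 3)) ⊕ c                       ≈⟨ ⊕-congʳ (^-assocʳ X m 3) ⟨
      -- With c' = -e, the product (y + c)(1 + c' y + y^2) has the additional terms (c + c') y^2 and
      -- (1 + c c') y. They are inserted here as zeros: c + c' = 0, and 1 + c c' = 1 - e^2 = 0.
      (y ⊗ (y ⊗ (y ⊗ [ 1 ]))) ⊕ c               ≈⟨ solve 2 (λ y c → y :* (y :* (y :* con 1)) :+ c := (y :* (y :* y) :+ c) :+ (con 0 :* (y :* y) :+ con 0 :* y)) ≃-refl y c ⟩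
      ((y ⊗ (y ⊗ y)) ⊕ c) ⊕ (([] ⊗ (y ⊗ y)) ⊕ ([] ⊗ y)) ≈⟨ ⊕-congˡ (⊕-cong (⊗-cong c⊕c′ (≃-refl {y ⊗ y})) (⊗-cong 1⊕cc′ (≃-refl {y}))) ⟨
      ((y ⊗ (y ⊗ y)) ⊕ c) ⊕ (((c ⊕ c′) ⊗ (y ⊗ y)) ⊕ (([ 1 ] ⊕ (c ⊗ c′)) ⊗ y))
        ≈⟨ solve 3 (λ y c c′ → (y :* (y :* y) :+ c) :+ ((c :+ c′) :* (y :* y) :+ (con 1 :+ c :* c′) :* y)
                            := (y :+ c) :* ((con 1 :+ c′ :* y) :+ y :* y)) ≃-refl y c c′ ⟩
      (y ⊕ c) ⊗ F (ν ℕ.* e) m                   ∎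
      where
      open SetoidReasoning setoid
      y = X ^ m
      c = [ e ]
      c′ = [ ν ℕ.* e ]
      c⊕c′ : c ⊕ c′ ≃ []
      c⊕c′ = [0]≃ (*-congₘ 1+ν≡0 (≡ₘ-refl {e}))
      1⊕cc′ : [ 1 ] ⊕ (c ⊗ c′) ≃ []
      1⊕cc′ = ≃-trans (⊕-congˡ {[ 1 ]} ([a]⊗[b] e (ν ℕ.* e))) ([0]≃ (≡ₘ-trans (+-congₘ (≡ₘ-refl {1})
        (≡ₘ-trans (≡⇒≡ₘ (ℕS.solve 2 (λ n e → e ℕS.:* (n ℕS.:* e) ℕS.:= n ℕS.:* (e ℕS.:* e)) ≡.refl ν e)) (≡ₘ-trans (*-congₘ (≡ₘ-refl {ν}) e²≡1) (≡⇒≡ₘ (ℕₚ.*-identityʳ ν))))) 1+ν≡0))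

-- The F-set and its closure property.

module CyclotomicFSet (p : ℕ) (pp : Prime p) (p%9 : p % 9 ≡ 2 ⊎ p % 9 ≡ 5) where
  open Poly p pp
  open PolyRing p pp
  open PolyDivision p pp
  open Cyclotomic p pp p%9
  open NatSolver polySemiring using (solve; _:*_; _:+_; _:=_; con)
  open import Algebra.Properties.CommutativeSemiring.Exp polySemiring

  private instance
    p≢0 = prime⇒nonZero pp

  -- The signs 1 and -1 are encoded as square roots of 1 modulo p, which treats both at once and
  -- also covers p = 2, where they coincide.
  data Member (f : RawPoly) : Set where
    is-X   : f ≃ X → Member f
    is-X⊕e : ∀ {e} → e ℕ.* e ≡ₘ 1 → f ≃ X ⊕ [ e ] → Member f
    is-F   : ∀ {e} k → e ℕ.* e ≡ₘ 1 → f ≃ F e (3 ℕ.^ k) → Member f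

  X-monic : MonicDeg X 1
  X-monic = monic-resp (solve 1 (λ x → x :* con 1 := x) ≃-refl X) (X^-monic 1)

  toRaw-monic : ∀ P → MonicDeg (toRaw P) (proj₁ P)
  toRaw-monic (zero  , [])     = mkMonic ≡ₘ-refl (λ { (suc i) _ → ≡ₘ-refl })
  toRaw-monic (suc d , c ∷ cs) with toRaw-monic (d , cs)
  ... | mkMonic l a = mkMonic l (λ { (suc i) (s<s d<i) → a i d<i })

  tail : RawPoly → RawPoly
  tail []      = []
  tail (a ∷ f) = f

  coeff-tail : ∀ f i → coeff (tail f) i ≡ coeff f (suc i)
  coeff-tail []      i = ≡.refl
  coeff-tail (a ∷ f) i = ≡.refl

  fromRaw : ∀ d f → MonicDeg f d → ∃ λ (v : Vec (Fin p) d) → vecToRaw v ≃ f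
  fromRaw zero    f (mkMonic l a) = [] , mk≃ (λ { zero → ≡ₘ-sym l ; (suc i) → ≡ₘ-sym (a (suc i) z<s) })
  fromRaw (suc d) f (mkMonic l a) with fromRaw d (tail f) (mkMonic (≡ₘ-trans (≡⇒≡ₘ (coeff-tail f d)) l) (λ i d<i → ≡ₘ-trans (≡⇒≡ₘ (coeff-tail f i)) (a (suc i) (s<s d<i))))
  ... | v , mk≃ eq = fromℕ< (m%n<n (coeff f 0) p) ∷ v , mk≃ (λ
      { zero    → ≡ₘ-trans (≡⇒≡ₘ (toℕ-fromℕ< (m%n<n (coeff f 0) p))) (mkₘ (m%n%n≡m%n (coeff f 0) p))
      ; (suc i) → ≡ₘ-trans (eq i) (≡⇒≡ₘ (coeff-tail f i)) })

  minusConst-unique : ∀ {f g} c → f ≃ g ⊕ [ c ] → coeff g 0 ≡ₘ 0 → minusConst f ≃ g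
  minusConst-unique {f} {g} c (mk≃ eq) g₀≡0 = mk≃ (λ i → ≡ₘ-trans (≡⇒≡ₘ (coeff-⊕ f [ p ∸ constTerm f ] i)) (compare i))
    where
    compare : ∀ i → coeff f i ℕ.+ coeff [ p ∸ constTerm f ] i ≡ₘ coeff g i
    compare zero = ≡ₘ-trans (+-congₘ (≡ₘ-sym (mkₘ (m%n%n≡m%n (coeff f 0) p))) (≡ₘ-refl {p ∸ constTerm f}))
      (≡ₘ-trans (≡⇒≡ₘ (ℕₚ.m+[n∸m]≡n (ℕₚ.<⇒≤ (m%n<n (coeff f 0) p)))) (≡ₘ-trans (∣⇒≡ₘ0 ∣.∣-refl) (≡ₘ-sym g₀≡0)))
    compare (suc i) = ≡ₘ-trans (≡⇒≡ₘ (ℕₚ.+-identityʳ _)) (≡ₘ-trans (eq (suc i)) (≡⇒≡ₘ (≡.trans (coeff-⊕ g [ c ] (suc i)) (ℕₚ.+-identityʳ _))))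

  coeff₀-X⊗ : ∀ f → coeff (X ⊗ f) 0 ≡ₘ 0
  coeff₀-X⊗ f = coeffs (X⊗ f) 0

  minusConst-F : ∀ {f} e m → 0 ℕ.< m → f ≃ F e m → minusConst f ≃ (X ^ m) ⊗ ((X ^ m) ⊕ [ e ])
  minusConst-F {f} e (suc m) _ f≃F = minusConst-unique 1 (≃-trans f≃F (expand (X ^ suc m) [ e ]))
    (≡ₘ-trans (coeffs (⊗-assoc X (X ^ m) ((X ^ suc m) ⊕ [ e ])) 0) (coeff₀-X⊗ _))
    where
    expand : ∀ y c → ([ 1 ] ⊕ (c ⊗ y)) ⊕ (y ⊗ y) ≃ (y ⊗ (y ⊕ c)) ⊕ [ 1 ]
    expand = solve 2 (λ y c → (con 1 :+ c :* y) :+ y :* y := y :* (y :+ c) :+ con 1) ≃-refl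

  minusConst-X⊕e : ∀ {f} e → f ≃ X ⊕ [ e ] → minusConst f ≃ X
  minusConst-X⊕e e f≃ = minusConst-unique e f≃ X₀
    where
    X₀ : coeff X 0 ≡ₘ 0
    X₀ rewrite X≡ = ≡ₘ-refl

  minusConst-X : ∀ {f} → f ≃ X → minusConst f ≃ X
  minusConst-X f≃X = minusConst-X⊕e 0 (≃-trans f≃X (≃-sym (≃-trans (⊕-congˡ {X} 0∷[]≃[]) (⊕-identityʳ X))))

  module _ (Q : Monic) (irr : MonicIrreducible Q) where
    private
      q = toRaw Q

    ∣X⇒Member : q ∣ᵖ X → Member q
    ∣X⇒Member q∣ = is-X (irreducible-∣⇒≃ irr (linear-irreducible (monic⇒Deg X-monic)) (toRaw-monic Q) X-monic q∣)

    ∣X⊕e⇒Member : ∀ {e} → e ℕ.* e ≡ₘ 1 → q ∣ᵖ X ⊕ [ e ] → Member q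
    ∣X⊕e⇒Member {e} e² q∣ = is-X⊕e e² (irreducible-∣⇒≃ irr (linear-irreducible (monic⇒Deg (X⊕-monic e))) (toRaw-monic Q) (X⊕-monic e) q∣)

    ∣F⇒Member : ∀ {e} k → e ℕ.* e ≡ₘ 1 → q ∣ᵖ F e (3 ℕ.^ k) → Member q
    ∣F⇒Member {e} k e² q∣ = is-F k e² (irreducible-∣⇒≃ irr (F-irreducible e² k) (toRaw-monic Q) (F-monic e (3 ℕ.^ k) (0<3^ k)) q∣)

    ∣X^⇒∣X : ∀ m → q ∣ᵖ X ^ m → q ∣ᵖ X
    ∣X^⇒∣X zero    (h , eq) = contradiction (h , ≃⇒≈ (≃-sym eq)) (proj₁ (proj₂ irr))
    ∣X^⇒∣X (suc m) q∣ = [ (λ q∣X → q∣X) , ∣X^⇒∣X m ]′ (irreducible⇒prime irr X (X ^ m) q∣)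

    -- Descent on k: each step splits off a factor `F` with sign -e and keeps x^(3^k) + e with the
    -- same e, until x + e is reached. An irreducible divisor, being prime, divides one of these
    -- factors.
    ∣X^3^k⊕e⇒Member : ∀ {e} → e ℕ.* e ≡ₘ 1 → ∀ k → q ∣ᵖ (X ^ (3 ℕ.^ k)) ⊕ [ e ] → Member q
    ∣X^3^k⊕e⇒Member {e} e² zero q∣ = ∣X⊕e⇒Member e² (∣ᵖ-resp (⊕-congʳ {[ e ]} (solve 1 (λ x → x :* con 1 := x) ≃-refl X)) q∣)
    ∣X^3^k⊕e⇒Member {e} e² (suc k) q∣ = [ ∣X^3^k⊕e⇒Member e² k , ∣F⇒Member k (ν*e²≡1 e²) ]′
      (irreducible⇒prime irr ((X ^ (3 ℕ.^ k)) ⊕ [ e ]) (F (ν ℕ.* e) (3 ℕ.^ k)) (∣ᵖ-resp (X^3m⊕e e² (3 ℕ.^ k)) q∣))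

    closed : ∀ {f} → Member f → q ∣ᵖ minusConst f → Member q
    closed (is-X f≃)            q∣ = ∣X⇒Member (∣ᵖ-resp (minusConst-X f≃) q∣)
    closed (is-X⊕e {e} _ f≃)    q∣ = ∣X⇒Member (∣ᵖ-resp (minusConst-X⊕e e f≃) q∣)
    closed (is-F {e} k e² f≃) q∣ = [ (λ q∣X^m → ∣X⇒Member (∣X^⇒∣X (3 ℕ.^ k) q∣X^m)) , ∣X^3^k⊕e⇒Member e² k ]′
      (irreducible⇒prime irr (X ^ (3 ℕ.^ k)) ((X ^ (3 ℕ.^ k)) ⊕ [ e ]) (∣ᵖ-resp (minusConst-F e (3 ℕ.^ k) (0<3^ k) f≃) q∣))

  S : Monic → Set
  S P = MonicIrreducible P × Member (toRaw P)

  S-isFSet : IsFSet S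
  S-isFSet = (λ P → proj₁) , λ P Q (_ , P∈S) irr (h , eq) →
    irr , closed Q irr P∈S (h , ≈⇒≃ {minusConst (toRaw P)} {toRaw Q ⊗ h} eq)

  -- Infinitude and nontriviality of the set.

  fromIrreducible : ∀ {f d} → MonicDeg f d → Irreducible f → ∃ λ v → MonicIrreducible (d , v) × toRaw (d , v) ≃ f
  fromIrreducible {f} {d} M irr with fromRaw d f M
  ... | v , v≃f = v , Irreducible-resp (≃-sym v≃f) irr , v≃f

  -- A crude bound for every degree occurring in a finite list; any polynomial of larger degree lies
  -- outside the list.
  totalDegree : List Monic → ℕ
  totalDegree []             = 0
  totalDegree ((d , _) ∷ xs) = d ℕ.+ totalDegree xs

  ∈⇒deg≤ : ∀ {P xs} → P ∈ xs → proj₁ P ℕ.≤ totalDegree xs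
  ∈⇒deg≤ {xs = (d , _) ∷ xs} (here ≡.refl) = ℕₚ.m≤m+n d (totalDegree xs)
  ∈⇒deg≤ {xs = (d , _) ∷ xs} (there P∈xs)  = ℕₚ.≤-trans (∈⇒deg≤ P∈xs) (ℕₚ.m≤n+m (totalDegree xs) d)

  n<3^n : ∀ n → n ℕ.< 3 ℕ.^ n
  n<3^n zero    = z<s
  n<3^n (suc n) = ℕₚ.<-≤-trans (ℕₚ.+-monoʳ-< 1 (n<3^n n)) (ℕₚ.+-mono-≤ (0<3^ n) (ℕₚ.m≤m+n (3 ℕ.^ n) _))

  S-unbounded : ∀ k → ∃ λ P → S P × k ℕ.< proj₁ P
  S-unbounded k = bound (fromIrreducible (F-monic 1 (3 ℕ.^ k) (0<3^ k)) (F1-irreducible k))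
    where
    bound : (∃ λ v → MonicIrreducible (3 ℕ.^ k ℕ.+ 3 ℕ.^ k , v) × toRaw (_ , v) ≃ F 1 (3 ℕ.^ k)) → ∃ λ P → S P × k ℕ.< proj₁ P
    bound (v , irr , v≃F) = (_ , v) , (irr , is-F k ≡ₘ-refl v≃F) , ℕₚ.<-≤-trans (n<3^n k) (ℕₚ.m≤m+n (3 ℕ.^ k) (3 ℕ.^ k))

  S-infinite : Infinite S
  S-infinite (xs , covers) with S-unbounded (totalDegree xs)
  ... | P , P∈S , deg> = ℕₚ.<⇒≱ deg> (∈⇒deg≤ (covers P P∈S))

  nonmember⇒Nontrivial : ∀ {f d} → MonicDeg f d → Irreducible f → (∀ {g} → g ≃ f → ¬ Member g) → Nontrivial S
  nonmember⇒Nontrivial M irr f∉ all with fromIrreducible M irr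
  ... | v , irr′ , v≃f = f∉ v≃f (proj₂ (all (_ , v) irr′))

  -- Odd degrees above 1 do not occur, which is all that the exclusion of the cubic for p = 2 needs.
  Member⇒degree : ∀ {f d} → MonicDeg f d → Member f → d ≡ 1 ⊎ ∃ λ m → d ≡ m ℕ.+ m
  Member⇒degree M (is-X f≃)          = inj₁ (Deg-unique (monic⇒Deg M) (monic⇒Deg (monic-resp (≃-sym f≃) X-monic)))
  Member⇒degree M (is-X⊕e {e} _ f≃)  = inj₁ (Deg-unique (monic⇒Deg M) (monic⇒Deg (monic-resp (≃-sym f≃) (X⊕-monic e))))
  Member⇒degree M (is-F {e} k _ f≃)  = inj₂ (3 ℕ.^ k , Deg-unique (monic⇒Deg M) (monic⇒Deg (monic-resp (≃-sym f≃) (F-monic e (3 ℕ.^ k) (0<3^ k)))))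

  1≢m+m : ∀ m → 1 ≢ m ℕ.+ m
  1≢m+m (suc m) eq with () ← ≡.trans (ℕₚ.suc-injective eq) (ℕₚ.+-suc m m)

  3≢m+m : ∀ m → 3 ≢ m ℕ.+ m
  3≢m+m (suc m) eq = 1≢m+m m (ℕₚ.suc-injective (≡.trans (ℕₚ.suc-injective eq) (ℕₚ.+-suc m m)))

  X⊕-injective : ∀ {a b} → X ⊕ [ a ] ≃ X ⊕ [ b ] → a ≡ₘ b
  X⊕-injective rewrite X≡ = λ eq → coeffs eq 0

  -- For odd p the constant 2 is nonzero, and 4 = 1 modulo p would make p divide 3. The even degree
  -- of `F` excludes the last case.
  X⊕2-nonmember : p ≢ 2 → ∀ {g} → g ≃ X ⊕ [ 2 ] → ¬ Member g
  X⊕2-nonmember p≢2 g≃ (is-X g≃X) = 2≢ₘ0 (X⊕-injective (≃-trans (≃-trans (≃-sym g≃) g≃X) (≃-sym (≃-trans (⊕-congˡ {X} 0∷[]≃[]) (⊕-identityʳ X)))))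
    where
    2≢ₘ0 : ¬ 2 ≡ₘ 0
    2≢ₘ0 eq = p≢2 (ℕₚ.≤-antisym (∣.∣⇒≤ (≡ₘ0⇒∣ eq)) (ℕ.nonTrivial⇒n>1 p {{prime⇒nonTrivial pp}}))
  X⊕2-nonmember _ g≃ (is-X⊕e {e} e² g≃Xe) = 3≢ₘ0 3≡0
    where
    2≡e : 2 ≡ₘ e
    2≡e = X⊕-injective (≃-trans (≃-sym g≃) g≃Xe)
    3≡0 : 3 ≡ₘ 0
    -- Adding 1 + ν, which is zero, turns 3 into 4 + ν; then 4 = e^2 = 1 turns this into 1 + ν
    -- again.
    3≡0 = ≡ₘ-trans (+-congₘ (≡ₘ-refl {3}) (≡ₘ-sym 1+ν≡0))
      (≡ₘ-trans (+-congₘ {4} {1} {ν} (≡ₘ-trans (*-congₘ 2≡e 2≡e) e²) ≡ₘ-refl) 1+ν≡0)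
  X⊕2-nonmember _ g≃ (is-F {e} k _ g≃F) = 1≢m+m (3 ℕ.^ k) (Deg-unique (monic⇒Deg (monic-resp (≃-sym g≃) (X⊕-monic 2)))
    (monic⇒Deg (monic-resp (≃-sym g≃F) (F-monic e (3 ℕ.^ k) (0<3^ k)))))

  module _ (p≡2 : p ≡ 2) where

    -- Over F_2 the irreducibles of degree at most 2 are x, x + 1 and `F 1 1`, all of them members,
    -- so a candidate outside the set has degree at least 3.
    cubic : RawPoly
    cubic = 1 ∷ 1 ∷ 0 ∷ 1 ∷ []

    cubic-monic : MonicDeg cubic 3
    cubic-monic = mkMonic ≡ₘ-refl (λ { (suc (suc (suc (suc i)))) _ → ≡ₘ-refl ; (suc (suc (suc zero))) (s≤s (s≤s (s≤s ()))) ; (suc (suc zero)) (s≤s (s≤s ())) ; (suc zero) (s≤s ()) })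

    2≡0 : 2 ≡ₘ 0
    2≡0 = ∣⇒≡ₘ0 (∣.∣-reflexive p≡2)

    parity : ∀ c → c ≡ₘ 0 ⊎ c ≡ₘ 1
    parity zero    = inj₁ ≡ₘ-refl
    parity (suc c) with parity c
    ... | inj₁ c≡0 = inj₂ (+-congₘ (≡ₘ-refl {1}) c≡0)
    ... | inj₂ c≡1 = inj₁ (≡ₘ-trans (+-congₘ (≡ₘ-refl {1}) c≡1) 2≡0)

    -- The cubic takes the value 1 at both elements of F_2, so its remainder on division by x and by
    -- x + 1 is 1. The quotients `h` used below are x^2 + 1 and x^2 + x; a linear factor would have
    -- to divide the remainder.
    no-linear-factor : ∀ a b → Deg a 1 → ¬ cubic ≃ a ⊗ b
    no-linear-factor a b D eq = 1≢ₘ0 (Deg>0⇒¬∣constant D (_∣ᵖ_.factors (a∣1 (parity (coeff a 0)) (parity (coeff a 1)))))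
      where
      a≃ : ∀ {c} → coeff a 0 ≡ₘ c → coeff a 1 ≡ₘ 1 → a ≃ c ∷ 1 ∷ []
      a≃ c₀ c₁ = mk≃ (λ { zero → c₀ ; (suc zero) → c₁ ; (suc (suc i)) → above D (suc (suc i)) (s≤s (s≤s z≤n)) })
      remainder : ∀ {a′ h} → a ≃ a′ → cubic ≃ [ 1 ] ⊕ (a′ ⊗ h) → a ∣ᵖ [ 1 ]
      remainder {a′} {h} a≃a′ cubic≃ = balance⇒∣ᵖ {h = h} {k = b} (≃-trans (⊕-congˡ {[ 1 ]} (⊗-cong a≃a′ (≃-refl {h}))) (≃-trans (≃-sym cubic≃) eq))
      a∣1 : coeff a 0 ≡ₘ 0 ⊎ coeff a 0 ≡ₘ 1 → coeff a 1 ≡ₘ 0 ⊎ coeff a 1 ≡ₘ 1 → a ∣ᵖ [ 1 ]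
      a∣1 _         (inj₁ l≡0) = contradiction l≡0 (lead≢0 D)
      a∣1 (inj₁ c₀) (inj₂ c₁)  = remainder {h = 1 ∷ 0 ∷ 1 ∷ []} (a≃ c₀ c₁)
        (exact λ { 0 → ≡.refl ; 1 → ≡.refl ; 2 → ≡.refl ; 3 → ≡.refl ; (suc (suc (suc (suc i)))) → ≡.refl })
      a∣1 (inj₂ c₀) (inj₂ c₁)  = remainder {h = 0 ∷ 1 ∷ 1 ∷ []} (a≃ c₀ c₁)
        (mk≃ λ { 0 → ≡ₘ-refl ; 1 → ≡ₘ-refl ; 2 → ≡ₘ-sym 2≡0 ; 3 → ≡ₘ-refl ; (suc (suc (suc (suc i)))) → ≡ₘ-refl })

    cubic-irreducible : Irreducible cubic
    cubic-irreducible = irreducible-criterion (monic⇒Deg cubic-monic) noFactor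
      where
      noFactor : ∀ a b m n → cubic ≃ a ⊗ b → Deg a (suc m) → Deg b (suc n) → suc m ℕ.+ suc n ≢ 3
      noFactor a b zero    n       eq Da Db _ = no-linear-factor a b Da eq
      noFactor a b (suc m) zero    eq Da Db _ = no-linear-factor b a Db (≃-trans eq (⊗-comm a b))
      noFactor a b (suc m) (suc n) eq Da Db e = ℕₚ.m+1+n≢0 m (ℕₚ.suc-injective (≡.trans (≡.sym (ℕₚ.+-suc m (suc n))) (ℕₚ.suc-injective (ℕₚ.suc-injective e))))

    cubic-nonmember : ∀ {g} → g ≃ cubic → ¬ Member g
    cubic-nonmember g≃ g∈ with Member⇒degree (monic-resp (≃-sym g≃) cubic-monic) g∈
    ... | inj₂ (m , 3≡m+m) = 3≢m+m m 3≡m+m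

  S-nontrivial : Nontrivial S
  S-nontrivial with p ℕ.≟ 2
  ... | yes p≡2 = nonmember⇒Nontrivial (cubic-monic p≡2) (cubic-irreducible p≡2) (cubic-nonmember p≡2)
  ... | no  p≢2 = nonmember⇒Nontrivial (X⊕-monic 2) (linear-irreducible (monic⇒Deg (X⊕-monic 2))) (X⊕2-nonmember p≢2)

theorem1p1 : (p : ℕ) → (pp : Prime p) → (p % 9 ≡ 2 ⊎ p % 9 ≡ 5)
    → ∃ λ (S : Poly.Monic p pp → Set)
    → Poly.IsFSet p pp S × Poly.Nontrivial p pp S × Poly.Infinite p pp S
theorem1p1 p pp p%9 = S , S-isFSet , S-nontrivial , S-infinite
  where
  open CyclotomicFSet p pp p%9
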